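{- Let $N=\{1,\dots,n\}$ index the points to be clustered, let $d(i,j)$ ($i,j\in N$) be a real-valued distance with $d(i,i)=0$, let $k$ with $1\le k\le n$ be the number of clusters, let $G$ be a constant denoting the fewest number of elements permitted in any cluster, let $\lambda$ be a parameter, and run the Adaptive MinMax Starting Method (defined in the context). Consider any iteration $k_o\in\{k,k-1,\dots,1\}$, and let $N_o\subseteq N$ be the set of available points at that iteration (before it is updated), $n_o=|N_o|$. For $i\in N_o$ let $j_1,j_2,\dots,j_{n_o-1}$ (depending on $i$) be the points of $N_o\setminus\{i\}$ in the order of the method's ordered list of $i$, so $d(i,j_1)\le\dots\le d(i,j_{n_o-1})$. For a cluster size $v$, let $C_{best}(v)$ denote a cluster that minimizes $\mathrm{MMSpan}(C)$ over all $C\subseteq N_o$ with $|C|=v$. Let $v^*$ be the best value of $v$, meaning the largest admissible one: $v$ is made as large as possible subject to $v\le\mathrm{MaxScan}+1$ and to $d(i,j_{v-1})\le\mathrm{DistanceLimit}$ for the point $i\in N_o$ from which the cluster is formed; this value is $v^*=\mathrm{BestScan}+1$ for $\mathrm{BestScan}$ at the conclusion of the iteration. Then the cluster $C(k_o)$ and the associated point $i^*$ identified at the conclusion of iteration $k_o$ respectively qualify to be $C_{best}(v^*)$ and its MinMax-centroid; that is, $C(k_o)\subseteq N_o$, $|C(k_o)|=v^*$, $$\mathrm{MMSpan}(C(k_o))=\min\{\mathrm{MMSpan}(C): C\subseteq N_o,\ |C|=v^*\},$$ and $i^*$ is a MinMax-centroid of $C(k_o)$.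
   Context: The distance $d$ is not required to be a metric or to be non-negative; only the convention $d(i,i)=0$ is adopted. For a set $C\subseteq N$ and $i\in C$, put $\mathrm{MaxDist}(i:C)=\max\{d(i,j): j\in C\setminus\{i\}\}$. A MinMax-centroid of $C$ is a point $i^*\in C$ with $\mathrm{MaxDist}(i^*:C)=\min\{\mathrm{MaxDist}(i:C): i\in C\}$, and this minimum value is denoted $\mathrm{MMSpan}(C)$. $\mathit{Large}$ denotes a large positive number. Adaptive MinMax Starting Method. Preprocessing: for each $i\in N$ create an ordering $i(1),i(2),\dots,i(n-1)$ of $N\setminus\{i\}$ with $d(i,i(1))\le d(i,i(2))\le\dots\le d(i,i(n-1))$. Initialize $N_o=N$, $n_o=n$. For $k_o=k,k-1,\dots,1$ do the following. Sizes. Set $\mathrm{MinSize}=\lceil n_o/k_o\rceil$, $\mathrm{MaxSize}=n_o-G\cdot(k_o-1)$, $\mathrm{MinScan}=\mathrm{MinSize}-1$, $\mathrm{MaxScan}=\mathrm{MaxSize}-1$. Phase 1 (assumes that $N_o$ contains at least 2 elements). Set $\mathrm{BestDistance}=\mathit{Large}$ and $\mathrm{BestMinGap}=0$. For each $i\in N_o$: set $\mathrm{MinGap}=\mathit{Large}$, $\mathrm{SumGap}=0$, $\mathrm{Scan}=0$. For $s=1,\dots,n-1$, let $j=i(s)$ and, if $j\in N_o$: increase $\mathrm{Scan}$ by 1; set $\mathrm{Distance}=d(i,j)$; if $\mathrm{Scan}>1$, let $\mathrm{Gap}=\mathrm{Distance}-\mathrm{PreviousDistance}$, add $\mathrm{Gap}$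 to $\mathrm{SumGap}$ and replace $\mathrm{MinGap}$ by $\min(\mathrm{Gap},\mathrm{MinGap})$; if $\mathrm{Scan}=\mathrm{MinScan}$, set $s(i)=s$ and leave the loop over $s$; set $\mathrm{PreviousDistance}=\mathrm{Distance}$. After the loop over $s$, if $\mathrm{Distance}<\mathrm{BestDistance}$, or if $\mathrm{Distance}=\mathrm{BestDistance}$ and $\mathrm{MinGap}>\mathrm{BestMinGap}$, set $\mathrm{BestDistance}=\mathrm{Distance}$, $\mathrm{BestMinGap}=\mathrm{MinGap}$, $\mathrm{BestSumGap}=\mathrm{SumGap}$. After all $i\in N_o$ have been examined, set $\mathrm{BestMeanGap}=\mathrm{BestSumGap}/(\mathrm{MinScan}-1)$, $\mathrm{TargetGap}=\lambda\cdot\mathrm{BestMeanGap}+(1-\lambda)\cdot\mathrm{BestMinGap}$ (suggested default $\lambda=0.3$), and $\mathrm{DistanceLimit}=\mathrm{BestDistance}+\mathrm{TargetGap}$. Phase 2. Reset $\mathrm{BestDistance}=\mathit{Large}$ and set $\mathrm{BestScan}=\mathrm{MinScan}-1$. For each $i\in N_o$: set $\mathrm{Scan}=\mathrm{MinScan}-1$. For $s=s(i),\dots,n-1$, let $j=i(s)$ and, if $j\in N_o$: increase $\mathrm{Scan}$ by 1; if $d(i,j)>\mathrm{DistanceLimit}$, decrease $\mathrm{Scan}$ by 1 and leave the loop over $s$; otherwise set $\mathrm{Distance}=d(i,j)$, and leave the loop if $\mathrm{Scan}=\mathrm{MaxScan}$. After the loop over $s$, if $\mathrm{Scan}\ge\mathrm{MinScan}$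 and either $\mathrm{Scan}>\mathrm{BestScan}$, or $\mathrm{Scan}=\mathrm{BestScan}$ and $\mathrm{Distance}<\mathrm{BestDistance}$, set $i^*=i$, $\mathrm{BestScan}=\mathrm{Scan}$, $\mathrm{BestDistance}=\mathrm{Distance}$. Generate $C(k_o)$ and update $N_o$. Start with $C(k_o)=\emptyset$ and $\mathrm{Scan}=0$. For $s=1,\dots,n-1$, let $j=i^*(s)$ and, if $j\in N_o$, increase $\mathrm{Scan}$ by 1, move $j$ from $N_o$ to $C(k_o)$, and leave the loop if $\mathrm{Scan}=\mathrm{BestScan}$. Then move $i^*$ from $N_o$ to $C(k_o)$, record $i^*$ as the point associated with $C(k_o)$, and replace $n_o$ by $n_o-\mathrm{ClusterSize}$, where $\mathrm{ClusterSize}=\mathrm{BestScan}+1$. (Thus $C(k_o)$ consists of $i^*$ and the first $\mathrm{BestScan}$ points of its ordered list that were in $N_o$.) -}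

module Defs where

open import Level using (Level; _⊔_) renaming (suc to lsuc)
open import Algebra.Bundles using (CommutativeRing)
open import Algebra.Core using (Op₁; Op₂)
open import Algebra.Structures using (IsCommutativeRing)
import Algebra.Construct.NaturalChoice.Min as NaturalMin
import Algebra.Properties.Semiring.Mult as Mult
open import Data.Bool.Base using (if_then_else_)
open import Data.Fin.Base using (Fin; fromℕ<)
import Data.Fin.Properties as Fin
open import Data.Fin.Subset using (Subset; ⁅_⁆; _∈_; _⊆_; _∪_; _-_; ∣_∣) renaming (⊤ to full; ⊥ to empty)
open import Data.Fin.Subset.Properties using (_∈?_)
open import Data.List.Base using (List; []; _∷_; allFin; filter; foldl; head; length; lookup; map)
import Data.List.Extrema as Extrema
open import Data.List.Relation.Binary.Permutation.Propositional using (_↭_)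
open import Data.List.Relation.Unary.Linked using (Linked)
open import Data.Maybe.Base as Maybe using (Maybe; just; nothing)
import Data.Nat.Base as ℕ
open import Data.Nat.Base using (ℕ; zero; suc; _∸_)
open import Data.Nat.DivMod using (_/_)
import Data.Nat.Properties as ℕ
open import Data.Product.Base using (_×_; _,_; proj₁; proj₂)
open import Relation.Binary.Bundles using (DecTotalOrder; TotalOrder)
open import Relation.Binary.Core using (Rel)
open import Relation.Binary.Definitions using (Decidable)
open import Relation.Binary.PropositionalEquality.Core using (_≡_)
open import Relation.Binary.Structures using (IsDecTotalOrder)
import Relation.Binary.Construct.NonStrictToStrict as ToStrict
open import Relation.Nullary.Decidable using (does; ¬?; _×-dec_; _⊎-dec_)
open import Relation.Nullary.Negation using (¬_)

-- The library has no real numbers.  The distances live in an arbitrary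
-- ordered field with a decidable total order; classically ℝ is one.
record OrderedField (c ℓ₁ ℓ₂ : Level) : Set (lsuc (c ⊔ ℓ₁ ⊔ ℓ₂)) where
  infix  8 -_
  infix  9 _⁻¹
  infixl 7 _*_
  infixl 6 _+_
  infix  4 _≈_ _≤_
  field
    Carrier : Set c
    _≈_     : Rel Carrier ℓ₁
    _≤_     : Rel Carrier ℓ₂
    _+_     : Op₂ Carrier
    _*_     : Op₂ Carrier
    -_      : Op₁ Carrier
    -- Total, but with an unspecified value at 0#.
    _⁻¹     : Op₁ Carrier
    0#      : Carrier
    1#      : Carrier
    isCommutativeRing : IsCommutativeRing _≈_ _+_ _*_ -_ 0# 1#
    isDecTotalOrder   : IsDecTotalOrder _≈_ _≤_
    0≉1               : ¬ (0# ≈ 1#)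
    ⁻¹-inverseʳ       : ∀ x → ¬ (x ≈ 0#) → x * x ⁻¹ ≈ 1#
    +-monoˡ-≤         : ∀ z {x y} → x ≤ y → x + z ≤ y + z
    *-nonNegative     : ∀ {x y} → 0# ≤ x → 0# ≤ y → 0# ≤ x * y

  commutativeRing : CommutativeRing c ℓ₁
  commutativeRing = record { isCommutativeRing = isCommutativeRing }

  decTotalOrder : DecTotalOrder c ℓ₁ ℓ₂
  decTotalOrder = record { isDecTotalOrder = isDecTotalOrder }

  totalOrder : TotalOrder c ℓ₁ ℓ₂
  totalOrder = DecTotalOrder.totalOrder decTotalOrder

  open DecTotalOrder decTotalOrder public using (_≟_; _≤?_)

  infixl 6 _−_
  _−_ : Op₂ Carrier
  x − y = x + - y

  open ToStrict _≈_ _≤_ public using (_<_)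

  _<?_ : Decidable _<_
  _<?_ = ToStrict.<-decidable _≈_ _≤_ _≟_ _≤?_

  open NaturalMin totalOrder public using (_⊓_)

  fromℕ : ℕ → Carrier
  fromℕ m = m · 1#
    where open Mult (CommutativeRing.semiring commutativeRing) renaming (_×_ to _·_)

⌈_/_⌉ : ℕ → ℕ → ℕ
⌈ m / zero  ⌉ = 0
⌈ m / suc k ⌉ = (m ℕ.+ k) / suc k

members : ∀ {n} → Subset n → List (Fin n)
members {n} C = filter (_∈? C) (allFin n)

module Spans {c ℓ₁ ℓ₂ : Level} (F : OrderedField c ℓ₁ ℓ₂)
             {n : ℕ} (d : Fin n → Fin n → OrderedField.Carrier F) where
  open OrderedField F

  -- The value 0# on the empty list only matters for MaxDist (i : {i}),
  -- where it agrees with the convention d i i ≈ 0#.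
  maximum minimum : List Carrier → Carrier
  maximum []       = 0#
  maximum (x ∷ xs) = Extrema.max totalOrder x xs
  minimum []       = 0#
  minimum (x ∷ xs) = Extrema.min totalOrder x xs

  MaxDist : Fin n → Subset n → Carrier
  MaxDist i C = maximum (map (d i) (members (C - i)))

  MMSpan : Subset n → Carrier
  MMSpan C = minimum (map (λ i → MaxDist i C) (members C))

  IsMinMaxCentroid : Fin n → Subset n → Set ℓ₁
  IsMinMaxCentroid i C = i ∈ C × MaxDist i C ≈ MMSpan C

  IsCbest : Subset n → ℕ → Subset n → Set ℓ₂
  IsCbest Nₒ v C = C ⊆ Nₒ × ∣ C ∣ ≡ v
                 × (∀ C′ → C′ ⊆ Nₒ → ∣ C′ ∣ ≡ v → MMSpan C ≤ MMSpan C′)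

  IsOrdering : Fin n → List (Fin n) → Set ℓ₂
  IsOrdering i js = js ↭ filter (λ j → ¬? (j Fin.≟ i)) (allFin n)
                  × Linked (λ j j′ → d i j ≤ d i j′) js

-- order i is the list i(1), …, i(n-1); lam is the parameter λ.
module Method {c ℓ₁ ℓ₂ : Level} (F : OrderedField c ℓ₁ ℓ₂)
              {n : ℕ} (d : Fin n → Fin n → OrderedField.Carrier F)
              (k G : ℕ) (lam Large : OrderedField.Carrier F)
              (order : Fin n → List (Fin n)) where
  open OrderedField F

  record State : Set where
    constructor ⟨_,_⟩
    field
      Nₒ : Subset n
      nₒ : ℕ

  record Outcome : Set where
    field
      i*       : Fin n
      BestScan : ℕ
      cluster  : Subset n
      next     : State

  module Iteration (kₒ : ℕ) (σ : State) where
    open State σ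

    MinSize MaxSize MinScan MaxScan : ℕ
    MinSize = ⌈ nₒ / kₒ ⌉
    MaxSize = nₒ ∸ G ℕ.* (kₒ ∸ 1)
    MinScan = MinSize ∸ 1
    MaxScan = MaxSize ∸ 1

    -- A position s in the ordered list of i is represented by the suffix
    -- i(s), …, i(n-1); in particular `fromS` stands for s(i).
    record Phase1Vars : Set c where
      field
        Scan             : ℕ
        Distance         : Carrier
        PreviousDistance : Carrier
        MinGap           : Carrier
        SumGap           : Carrier
        fromS            : List (Fin n)

    -- Distance, PreviousDistance and fromS get placeholder values, as the
    -- method assigns them before they are read.
    phase1Init : Phase1Vars
    phase1Init = record
      { Scan = 0 ; Distance = 0# ; PreviousDistance = 0#
      ; MinGap = Large ; SumGap = 0# ; fromS = [] }

    phase1Visit : Fin n → Fin n → Phase1Vars → Phase1Vars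
    phase1Visit i j v = record v
      { Scan     = suc Scan
      ; Distance = d i j
      ; MinGap   = if does (1 ℕ.<? suc Scan) then Gap ⊓ MinGap else MinGap
      ; SumGap   = if does (1 ℕ.<? suc Scan) then SumGap + Gap else SumGap
      }
      where
      open Phase1Vars v
      Gap = d i j − PreviousDistance

    phase1Loop : Fin n → List (Fin n) → Phase1Vars → Phase1Vars
    phase1Loop i []       v = v
    phase1Loop i (j ∷ js) v =
      if does (j ∈? Nₒ)
      then (let v′ = phase1Visit i j v in
            if does (Phase1Vars.Scan v′ ℕ.≟ MinScan)
            then record v′ { fromS = j ∷ js }
            else phase1Loop i js
                   (record v′ { PreviousDistance = Phase1Vars.Distance v′ }))
      else phase1Loop i js v

    phase1 : Fin n → Phase1Vars
    phase1 i = phase1Loop i (order i) phase1Init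

    record Phase1Best : Set c where
      field
        BestDistance : Carrier
        BestMinGap   : Carrier
        BestSumGap   : Carrier

    phase1Update : Phase1Best → Fin n → Phase1Best
    phase1Update b i =
      if does ((Distance <? BestDistance)
               ⊎-dec ((Distance ≟ BestDistance) ×-dec (BestMinGap <? MinGap)))
      then record { BestDistance = Distance ; BestMinGap = MinGap ; BestSumGap = SumGap }
      else b
      where
      open Phase1Best b
      open Phase1Vars (phase1 i)

    -- The initial BestSumGap is a placeholder.
    phase1Best : Phase1Best
    phase1Best = foldl phase1Update
      (record { BestDistance = Large ; BestMinGap = 0# ; BestSumGap = 0# })
      (members Nₒ)

    -- If MinScan is 1 there are no gaps: BestSumGap is 0#, and the quotient
    -- 0/0 evaluates to 0#, whatever 0# ⁻¹ is.
    BestMeanGap TargetGap DistanceLimit : Carrier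
    BestMeanGap   = Phase1Best.BestSumGap phase1Best * (fromℕ (MinScan ∸ 1)) ⁻¹
    TargetGap     = lam * BestMeanGap + (1# − lam) * Phase1Best.BestMinGap phase1Best
    DistanceLimit = Phase1Best.BestDistance phase1Best + TargetGap

    -- The pair holds Scan and Distance.
    phase2Loop : Fin n → List (Fin n) → ℕ × Carrier → ℕ × Carrier
    phase2Loop i []       v                 = v
    phase2Loop i (j ∷ js) (Scan , Distance) =
      if does (j ∈? Nₒ)
      then (if does (DistanceLimit <? d i j)
            then Scan , Distance
            else (if does (suc Scan ℕ.≟ MaxScan)
                  then suc Scan , d i j
                  else phase2Loop i js (suc Scan , d i j)))
      else phase2Loop i js (Scan , Distance)

    phase2 : Fin n → ℕ × Carrier
    phase2 i = phase2Loop i (Phase1Vars.fromS (phase1 i))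
                 (MinScan ∸ 1 , Phase1Vars.Distance (phase1 i))

    record Phase2Best : Set c where
      field
        centre       : Maybe (Fin n)
        BestScan     : ℕ
        BestDistance : Carrier

    phase2Update : Phase2Best → Fin n → Phase2Best
    phase2Update b i =
      if does ((MinScan ℕ.≤? Scan)
               ×-dec ((BestScan ℕ.<? Scan)
                      ⊎-dec ((Scan ℕ.≟ BestScan) ×-dec (Distance <? BestDistance))))
      then record { centre = just i ; BestScan = Scan ; BestDistance = Distance }
      else b
      where
      open Phase2Best b
      Scan     = proj₁ (phase2 i)
      Distance = proj₂ (phase2 i)

    phase2Best : Phase2Best
    phase2Best = foldl phase2Update
      (record { centre = nothing ; BestScan = MinScan ∸ 1 ; BestDistance = Large })
      (members Nₒ)

    -- i* and BestScan, if the iteration finds an i*.  The phases presuppose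
    -- MinScan ≥ 1.  If MinScan is 0 (with 1 ≤ G and G kₒ ≤ nₒ this forces
    -- MaxScan = 0, so that only one-point clusters are allowed), an available
    -- point is taken by itself.
    choose : Maybe (Fin n × ℕ)
    choose =
      if does (MinScan ℕ.≟ 0)
      then Maybe.map (_, 0) (head (members Nₒ))
      else Maybe.map (_, Phase2Best.BestScan phase2Best) (Phase2Best.centre phase2Best)

    -- Moves the first m listed points that lie in the first set of the pair
    -- to the second set.
    moveFirst : ℕ → List (Fin n) → Subset n × Subset n → Subset n × Subset n
    moveFirst zero    js       p       = p
    moveFirst (suc m) []       p       = p
    moveFirst (suc m) (j ∷ js) (N , C) =
      if does (j ∈? N)
      then moveFirst m js (N - j , C ∪ ⁅ j ⁆)
      else moveFirst (suc m) js (N , C)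

    generate : Fin n × ℕ → Outcome
    generate (i* , BestScan) = record
      { i*       = i*
      ; BestScan = BestScan
      ; cluster  = proj₂ moved ∪ ⁅ i* ⁆
      ; next     = ⟨ proj₁ moved - i* , nₒ ∸ suc BestScan ⟩
      }
      where moved = moveFirst BestScan (order i*) (Nₒ , empty)

    iteration : Maybe Outcome
    iteration = Maybe.map generate choose

    -- The points j₁, j₂, … of Nₒ ∖ {i} in the order of the list of i.
    available : Fin n → List (Fin n)
    available i = filter (_∈? Nₒ) (order i)

    -- The sizes v with v ≤ MaxScan + 1 and d(i,j_{v-1}) ≤ DistanceLimit;
    -- j_{v-1} is entry v ∸ 2 of the list, counted from 0.  A one-point
    -- cluster involves no distance to another point.
    data Admissible (i : Fin n) : ℕ → Set ℓ₂ where
      one  : Admissible i 1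
      more : ∀ {m} → suc (suc m) ℕ.≤ suc MaxScan →
             (m< : m ℕ.< length (available i)) →
             d i (lookup (available i) (fromℕ< m<)) ≤ DistanceLimit →
             Admissible i (suc (suc m))

    IsLargestAdmissible : Fin n → ℕ → Set ℓ₂
    IsLargestAdmissible i* v = Admissible i* v
      × (∀ i → i ∈ Nₒ → ∀ v′ → Admissible i v′ → v′ ℕ.≤ v)

  -- Reached kₒ σ : the run arrives at iteration kₒ with σ as the current
  -- values of Nₒ and nₒ.
  data Reached : ℕ → State → Set where
    start : Reached k ⟨ full , n ⟩
    step  : ∀ {kₒ σ out} → Reached (suc kₒ) σ →
            Iteration.iteration (suc kₒ) σ ≡ just out →
            Reached kₒ (Outcome.next out)

{-# OPTIONS --safe #-}

-- The cluster formed around i with b further points has radius d(i, j_b), where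
-- j_b is the b-th available point in the list of i, and b points of Nₒ ∖ {i}
-- cannot all come before j_b: hence MaxDist(i : C) ≥ d(i, j_b) for every C ⊆ Nₒ
-- of b + 1 points containing i.  So the best clusters of that size are found by
-- minimising d(i, j_b) over i.  Phase 2 does this for b = BestScan: the points i
-- with d(i, j_b) ≤ DistanceLimit are compared by that very distance, and the other
-- points are farther than DistanceLimit, hence farther than the winner.
--
-- The size limits keep G kₒ ≤ nₒ, which gives MinScan ≤ MaxScan ≤ nₒ − 1.  For
-- 0 ≤ λ ≤ 1 moreover TargetGap ≥ 0, so the point attaining BestDistance in Phase 1
-- passes the test of Phase 2 and an iteration always finds some i*.

module Submission where

open import Defs
open import Level using (Level; _⊔_)
open import Algebra.Bundles using (CommutativeRing)
import Algebra.Construct.NaturalChoice.Min as NaturalMin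
import Algebra.Properties.Ring as RingProperties
open import Data.Bool.Base using (if_then_else_; true; false)
open import Data.Empty using (⊥-elim)
open import Data.Fin.Base using (Fin; zero; suc; fromℕ<)
import Data.Fin.Properties as Fin
open import Data.Fin.Subset
  using (Subset; inside; outside; Nonempty; ∣_∣; ⁅_⁆; _∈_; _∉_; _⊆_; _∪_; _-_)
open import Data.Fin.Subset.Properties
  using (_∈?_; nonempty?; Empty-unique; ∣⊥∣≡0; ∣⊤∣≡n; p─⊥≡p; p─q⊆p; ∪-identityʳ; x∈⁅x⁆; x∈⁅y⁆⇒x≡y;
         x∈p∪q⁻; x∈p∪q⁺; x∈p∧x≢y⇒x∈p-y; x∈p⇒∣p-x∣<∣p∣; drop-there; ∉⊥)
open import Data.List.Base using (List; []; _∷_; allFin; drop; filter; foldl; head; length; lookup; map)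
import Data.List.Extrema as Extrema
open import Data.List.Membership.Propositional using () renaming (_∈_ to _∈ˡ_; _∉_ to _∉ˡ_)
open import Data.List.Membership.Propositional.Properties using (∈-allFin; ∈-filter⁺; ∈-filter⁻; ∈-map⁺)
open import Data.List.Properties using (filter-accept; filter-reject; filter-none)
open import Data.List.Relation.Binary.Permutation.Propositional using (↭-sym; ↭⇒↭ₛ)
open import Data.List.Relation.Binary.Permutation.Propositional.Properties using (∈-resp-↭)
import Data.List.Relation.Binary.Permutation.Setoid.Properties as Permutation
open import Data.List.Relation.Unary.All as All using (All; []; _∷_)
import Data.List.Relation.Unary.All.Properties as All
open import Data.List.Relation.Unary.AllPairs using (AllPairs; []; _∷_)
import Data.List.Relation.Unary.AllPairs.Properties as AllPairs
open import Data.List.Relation.Unary.Any using (here; there)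
open import Data.List.Relation.Unary.Linked.Properties using (Linked⇒AllPairs)
open import Data.List.Relation.Unary.Unique.Propositional using (Unique)
import Data.List.Relation.Unary.Unique.Propositional.Properties as Unique
open import Data.Maybe.Base as Maybe using (Maybe; just; nothing)
open import Data.Nat.Base using (ℕ; zero; suc; _∸_; z≤n; s≤s; s≤s⁻¹)
  renaming (_≤_ to _≤ℕ_; _<_ to _<ℕ_; _*_ to _*ℕ_; _+_ to _+ℕ_)
import Data.Nat.Base as ℕ
import Data.Nat.DivMod as ℕ
import Data.Nat.Properties as ℕ
open import Data.Product.Base using (_×_; _,_; ∃; ∃₂; ∃-syntax; proj₁; proj₂)
open import Data.Sum.Base using (_⊎_; inj₁; inj₂; [_,_]′)
open import Data.Vec.Base using (_∷_)
import Data.Vec.Base as Vec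
open import Function.Base using (_∘_; id; case_of_)
open import Relation.Binary.Bundles using (DecTotalOrder)
open import Relation.Binary.Core using (Rel)
open import Relation.Binary.Definitions using (Reflexive; tri<; tri≈; tri>)
import Relation.Binary.Construct.NonStrictToStrict as ToStrict
open import Relation.Binary.PropositionalEquality
  using (_≡_; _≢_; refl; sym; trans; cong; subst; subst₂; setoid; module ≡-Reasoning)
open import Relation.Nullary.Decidable using (Dec; does; yes; no; _because_; ¬?; _×-dec_; _⊎-dec_)
open import Relation.Nullary.Negation using (¬_; contradiction)
open import Relation.Nullary.Reflects using (invert)

-- Conditionals, folds and `Maybe`.

private
  variable
    a p ℓ : Level
    A B : Set a
    n : ℕ

-- The explicit motive reaches a decision buried inside a goal, such as the composite tests of the
-- method, and each branch receives the proof or refutation behind it.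
if-elim : ∀ (P : A → Set p) {X : Set ℓ} (x? : Dec X) {u v : A} →
          (X → P u) → (¬ X → P v) → P (if does x? then u else v)
if-elim P (true  because r) f g = f (invert r)
if-elim P (false because r) f g = g (invert r)

foldl-preserves : ∀ (P : B → Set p) {f : B → A → B} xs {b} →
                  (∀ b x → x ∈ˡ xs → P b → P (f b x)) → P b → P (foldl f b xs)
foldl-preserves P []       step Pb = Pb
foldl-preserves P (x ∷ xs) step Pb =
  foldl-preserves P xs (λ b y y∈ → step b y (there y∈)) (step _ x (here refl) Pb)

-- Processing `x` establishes `D` by `self`, and `keep` carries it through every later element. This
-- compares a running optimum with each point examined.
foldl-absorbs : ∀ (D : B → A → Set p) {f : B → A → B} →
                (∀ b x → D (f b x) x) → (∀ b x y → D b y → D (f b x) y) →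
                ∀ xs {b x} → x ∈ˡ xs → D (foldl f b xs) x
foldl-absorbs D self keep (x ∷ xs) (here refl) =
  foldl-preserves (λ b → D b x) xs (λ b y _ → keep b y x) (self _ x)
foldl-absorbs D self keep (_ ∷ xs) (there x∈) = foldl-absorbs D self keep xs x∈

map-just⁻ : ∀ {f : A → B} (m : Maybe A) {y} → Maybe.map f m ≡ just y → ∃[ x ] (m ≡ just x × f x ≡ y)
map-just⁻ (just x) refl = x , refl , refl

head⇒∈ : ∀ (xs : List A) {x} → head xs ≡ just x → x ∈ˡ xs
head⇒∈ (x ∷ xs) refl = here refl

∈⇒head : ∀ {xs : List A} {x} → x ∈ˡ xs → ∃[ y ] head xs ≡ just y
∈⇒head {xs = y ∷ _} _ = y , refl

-- Positions in lists.

infix 4 _[_]=_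

-- A relation in place of `lookup`, so that no bound proof has to be carried when positions are
-- shifted. Positions count from 0: the point j_b of the method sits at position `b ∸ 1`.
data _[_]=_ {A : Set a} : List A → ℕ → A → Set a where
  here  : ∀ {x xs} → (x ∷ xs) [ 0 ]= x
  there : ∀ {x y xs m} → xs [ m ]= y → (x ∷ xs) [ suc m ]= y

[]=-lookup : ∀ (xs : List A) {m} (m< : m <ℕ length xs) → xs [ m ]= lookup xs (fromℕ< m<)
[]=-lookup (x ∷ xs) {zero}  m<       = here
[]=-lookup (x ∷ xs) {suc m} (s≤s m<) = there ([]=-lookup xs m<)

[]=⇒< : ∀ {xs : List A} {m x} → xs [ m ]= x → m <ℕ length xs
[]=⇒< here      = s≤s z≤n
[]=⇒< (there q) = s≤s ([]=⇒< q)

[]=⇒lookup : ∀ {xs : List A} {m x} → xs [ m ]= x → (m< : m <ℕ length xs) → lookup xs (fromℕ< m<) ≡ x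
[]=⇒lookup here      (s≤s m<) = refl
[]=⇒lookup (there q) (s≤s m<) = []=⇒lookup q m<

[]=⇒∈ : ∀ {xs : List A} {m x} → xs [ m ]= x → x ∈ˡ xs
[]=⇒∈ here      = here refl
[]=⇒∈ (there q) = there ([]=⇒∈ q)

[]=-drop⁻ : ∀ m (xs : List A) {u x} → drop m xs [ u ]= x → xs [ m +ℕ u ]= x
[]=-drop⁻ zero    xs       q = q
[]=-drop⁻ (suc m) (x ∷ xs) q = there ([]=-drop⁻ m xs q)

[]=-drop⁺ : ∀ m (xs : List A) {u x} → xs [ m +ℕ u ]= x → drop m xs [ u ]= x
[]=-drop⁺ zero    xs       q         = q
[]=-drop⁺ (suc m) (x ∷ xs) (there q) = []=-drop⁺ m xs q

[]=-mono : ∀ {R : Rel A ℓ} → Reflexive R → ∀ {xs} → AllPairs R xs →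
           ∀ {u t x y} → u ≤ℕ t → xs [ u ]= x → xs [ t ]= y → R x y
[]=-mono R-refl (Rx ∷ Rxs) u≤t       here      here       = R-refl
[]=-mono R-refl (Rx ∷ Rxs) u≤t       here      (there q′) = All.lookup Rx ([]=⇒∈ q′)
[]=-mono R-refl (Rx ∷ Rxs) (s≤s u≤t) (there q) (there q′) = []=-mono R-refl Rxs u≤t q q′

-- Sizes of subsets and counting along a list.

0<∣p∣⇒Nonempty : ∀ (p : Subset n) → 0 <ℕ ∣ p ∣ → Nonempty p
0<∣p∣⇒Nonempty {n} p 0<∣p∣ with nonempty? p
... | yes ne = ne
... | no  ¬ne = contradiction (trans (cong ∣_∣ (Empty-unique ¬ne)) (∣⊥∣≡0 n)) (ℕ.>⇒≢ 0<∣p∣)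

x∉p-x : ∀ (p : Subset n) x → x ∉ p - x
x∉p-x (inside  ∷ p) zero    ()
x∉p-x (outside ∷ p) zero    ()
x∉p-x (s ∷ p)       (suc x) x∈ = x∉p-x p x (drop-there x∈)

x∈p-y⇒x≢y : ∀ {p : Subset n} {x y} → x ∈ p - y → x ≢ y
x∈p-y⇒x≢y {p = p} x∈ refl = x∉p-x p _ x∈

∣p∣≤1+∣p-x∣ : ∀ (p : Subset n) x → ∣ p ∣ ≤ℕ suc ∣ p - x ∣
∣p∣≤1+∣p-x∣ (inside  ∷ p) zero    = s≤s (ℕ.≤-reflexive (cong ∣_∣ (sym (p─⊥≡p p))))
∣p∣≤1+∣p-x∣ (outside ∷ p) zero    = ℕ.m≤n⇒m≤1+n (ℕ.≤-reflexive (cong ∣_∣ (sym (p─⊥≡p p))))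
∣p∣≤1+∣p-x∣ (inside  ∷ p) (suc x) = s≤s (∣p∣≤1+∣p-x∣ p x)
∣p∣≤1+∣p-x∣ (outside ∷ p) (suc x) = ∣p∣≤1+∣p-x∣ p x

x∈p⇒1+∣p-x∣≡∣p∣ : ∀ {p : Subset n} {x} → x ∈ p → suc ∣ p - x ∣ ≡ ∣ p ∣
x∈p⇒1+∣p-x∣≡∣p∣ {p = p} {x} x∈p = ℕ.≤-antisym (x∈p⇒∣p-x∣<∣p∣ x∈p) (∣p∣≤1+∣p-x∣ p x)

x∉p⇒∣p∪⁅x⁆∣≡1+∣p∣ : ∀ {p : Subset n} {x} → x ∉ p → ∣ p ∪ ⁅ x ⁆ ∣ ≡ suc ∣ p ∣
x∉p⇒∣p∪⁅x⁆∣≡1+∣p∣ {p = inside  ∷ p} {zero}  x∉p = ⊥-elim (x∉p Vec.here)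
x∉p⇒∣p∪⁅x⁆∣≡1+∣p∣ {p = outside ∷ p} {zero}  x∉p = cong (suc ∘ ∣_∣) (∪-identityʳ p)
x∉p⇒∣p∪⁅x⁆∣≡1+∣p∣ {p = inside  ∷ p} {suc x} x∉p = cong suc (x∉p⇒∣p∪⁅x⁆∣≡1+∣p∣ (x∉p ∘ Vec.there))
x∉p⇒∣p∪⁅x⁆∣≡1+∣p∣ {p = outside ∷ p} {suc x} x∉p = x∉p⇒∣p∪⁅x⁆∣≡1+∣p∣ (x∉p ∘ Vec.there)

∈-members⁺ : ∀ {C : Subset n} {i} → i ∈ C → i ∈ˡ members C
∈-members⁺ {C = C} = ∈-filter⁺ (_∈? C) (∈-allFin _)

∈-members⁻ : ∀ {C : Subset n} {i} → i ∈ˡ members C → i ∈ C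
∈-members⁻ {C = C} = proj₂ ∘ ∈-filter⁻ (_∈? C) {xs = allFin _}

-- By counting: each list element skipped removes at most one point from `S`, so after `t` of them
-- `S` still has a point, which occurs at position `t` or later. Sortedness then compares it with
-- the element at `t`.
∃-late-member : ∀ {R : Rel (Fin n) ℓ} → Reflexive R → ∀ xs → AllPairs R xs → ∀ (S : Subset n) →
                (∀ {x} → x ∈ S → x ∈ˡ xs) → ∀ {t} → t <ℕ ∣ S ∣ →
                ∃₂ λ y x → xs [ t ]= y × x ∈ S × R y x
∃-late-member R-refl [] _ S S⊆xs t<∣S∣
  with x , x∈S ← 0<∣p∣⇒Nonempty S (ℕ.≤-<-trans z≤n t<∣S∣) with () ← S⊆xs x∈S
∃-late-member R-refl (y ∷ xs) (Ry ∷ _) S S⊆xs {zero} 0<∣S∣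
  with x , x∈S ← 0<∣p∣⇒Nonempty S 0<∣S∣ with S⊆xs x∈S
... | here refl  = y , x , here , x∈S , R-refl
... | there x∈xs = y , x , here , x∈S , All.lookup Ry x∈xs
∃-late-member R-refl (z ∷ xs) (_ ∷ Rxs) S S⊆xs {suc t} t<∣S∣ =
  let y , x , q , x∈ , Ryx = ∃-late-member R-refl xs Rxs (S - z) S-z⊆xs
                               (s≤s⁻¹ (ℕ.<-≤-trans t<∣S∣ (∣p∣≤1+∣p-x∣ S z)))
  in  y , x , there q , p─q⊆p S _ x∈ , Ryx
  where
  S-z⊆xs : ∀ {x} → x ∈ S - z → x ∈ˡ xs
  S-z⊆xs x∈ with S⊆xs (p─q⊆p S _ x∈)
  ... | here x≡z = contradiction x≡z (x∈p-y⇒x≢y {p = S} x∈)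
  ... | there x∈xs = x∈xs

-- For use after `j` has been moved: the rest of a list without repetitions does not contain `j`, so
-- positions in it keep their points.
filter-remove : ∀ (N : Subset n) {j} js → j ∉ˡ js → filter (_∈? (N - j)) js ≡ filter (_∈? N) js
filter-remove N []       _  = refl
filter-remove N {j} (x ∷ js) j∉ with x ∈? N
... | yes x∈N = trans (filter-accept (_∈? (N - j)) (x∈p∧x≢y⇒x∈p-y x∈N λ x≡j → j∉ (here (sym x≡j))))
                      (cong (x ∷_) (filter-remove N js (j∉ ∘ there)))
... | no x∉N  = trans (filter-reject (_∈? (N - j)) (x∉N ∘ p─q⊆p N _))
                      (filter-remove N js (j∉ ∘ there))

-- The invariant of the run: the counter `nₒ` is accurate, and enough points remain for `kₒ`
-- clusters of `G` points each.
Feasible : ℕ → ℕ → Subset n → ℕ → Set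
Feasible G kₒ Nₒ nₒ = nₒ ≡ ∣ Nₒ ∣ × G *ℕ kₒ ≤ℕ nₒ

-- Ceiling division and multiplication.

⌈/⌉-≤ : ∀ {m k b} → m ≤ℕ b *ℕ suc k → ⌈ m / suc k ⌉ ≤ℕ b
⌈/⌉-≤ {m} {k} {b} m≤bk = s≤s⁻¹ (ℕ.m<n*o⇒m/o<n (begin-strict
  m +ℕ k             ≤⟨ ℕ.+-monoˡ-≤ k m≤bk ⟩
  b *ℕ suc k +ℕ k    <⟨ ℕ.+-monoʳ-< (b *ℕ suc k) (ℕ.n<1+n k) ⟩
  b *ℕ suc k +ℕ suc k ≡⟨ ℕ.+-comm (b *ℕ suc k) (suc k) ⟩
  suc b *ℕ suc k     ∎))
  where
  open ℕ.≤-Reasoning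

-- `m +ℕ k` is remainder plus quotient times `suc k`; the remainder is at most `k`, which then
-- cancels.
⌈/⌉-≥ : ∀ {m k b} → ⌈ m / suc k ⌉ ≤ℕ b → m ≤ℕ b *ℕ suc k
⌈/⌉-≥ {m} {k} {b} q≤b = ℕ.+-cancelʳ-≤ k _ _ (begin
  m +ℕ k                                       ≡⟨ ℕ.m≡m%n+[m/n]*n (m +ℕ k) (suc k) ⟩
  (m +ℕ k) ℕ.% suc k +ℕ ⌈ m / suc k ⌉ *ℕ suc k
    ≤⟨ ℕ.+-mono-≤ (s≤s⁻¹ (ℕ.m%n<n (m +ℕ k) (suc k))) (ℕ.*-monoˡ-≤ (suc k) q≤b) ⟩
  k +ℕ b *ℕ suc k                              ≡⟨ ℕ.+-comm k _ ⟩
  b *ℕ suc k +ℕ k                              ∎)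
  where
  open ℕ.≤-Reasoning

-- Nonnegativity in an ordered field.

module OrderedFieldProperties {c ℓ₁ ℓ₂ : Level} (F : OrderedField c ℓ₁ ℓ₂) where
  open OrderedField F
  open CommutativeRing commutativeRing using
    (ring; +-identityˡ; -‿inverseʳ; -‿cong; zeroˡ; +-comm)
    renaming (sym to ≈-sym; trans to ≈-trans)
  open RingProperties ring using (-1*x≈-x; -‿distribʳ-*; -‿involutive)
  open DecTotalOrder decTotalOrder public using ()
    renaming (reflexive to ≤-reflexive; refl to ≤-refl; trans to ≤-trans; antisym to ≤-antisym; total to ≤-total;
              module Eq to ≈)
  open DecTotalOrder decTotalOrder using (≤-respˡ-≈; ≤-respʳ-≈)

  ≮⇒≥ : ∀ {x y} → ¬ (x < y) → y ≤ x
  ≮⇒≥ = ToStrict.≮⇒≥ _≈_ _≤_ ≈.sym _≟_ ≤-reflexive ≤-total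

  <⇒≱ : ∀ {x y} → x < y → ¬ (y ≤ x)
  <⇒≱ = ToStrict.<⇒≱ _≈_ _≤_ ≤-antisym

  x≤y⇒0≤y−x : ∀ {x y} → x ≤ y → 0# ≤ y − x
  x≤y⇒0≤y−x {x} x≤y = ≤-respˡ-≈ (-‿inverseʳ x) (+-monoˡ-≤ (- x) x≤y)

  0≤y⇒x≤x+y : ∀ {x y} → 0# ≤ y → x ≤ x + y
  0≤y⇒x≤x+y {x} {y} 0≤y = ≤-respˡ-≈ (+-identityˡ x) (≤-respʳ-≈ (+-comm y x) (+-monoˡ-≤ x 0≤y))

  0≤x+y : ∀ {x y} → 0# ≤ x → 0# ≤ y → 0# ≤ x + y
  0≤x+y 0≤x 0≤y = ≤-trans 0≤x (0≤y⇒x≤x+y 0≤y)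

  x≤0⇒0≤-x : ∀ {x} → x ≤ 0# → 0# ≤ - x
  x≤0⇒0≤-x {x} x≤0 = ≤-respʳ-≈ (+-identityˡ (- x)) (x≤y⇒0≤y−x x≤0)

  -- If `1# ≤ 0#`, then `- 1#` is nonnegative and `1#` is its square.
  0≤1 : 0# ≤ 1#
  0≤1 with ≤-total 0# 1#
  ... | inj₁ 0≤1 = 0≤1
  ... | inj₂ 1≤0 = ≤-respʳ-≈ (≈-trans (-1*x≈-x (- 1#)) (-‿involutive 1#)) (*-nonNegative 0≤-1 0≤-1)
    where 0≤-1 = x≤0⇒0≤-x 1≤0

  0≤fromℕ : ∀ m → 0# ≤ fromℕ m
  0≤fromℕ zero    = ≤-refl
  0≤fromℕ (suc m) = 0≤x+y 0≤1 (0≤fromℕ m)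

  fromℕ[1+m]≉0 : ∀ m → ¬ (fromℕ (suc m) ≈ 0#)
  fromℕ[1+m]≉0 m eq = 0≉1 (≤-antisym 0≤1 (≤-respʳ-≈ eq (0≤y⇒x≤x+y (0≤fromℕ m))))

  -- A nonpositive inverse would make `x * - (x ⁻¹)`, which is `- 1#`, nonnegative.
  0≤x⁻¹ : ∀ {x} → 0# ≤ x → ¬ (x ≈ 0#) → 0# ≤ x ⁻¹
  0≤x⁻¹ {x} 0≤x x≉0 with ≤-total 0# (x ⁻¹)
  ... | inj₁ 0≤x⁻¹ = 0≤x⁻¹
  ... | inj₂ x⁻¹≤0 = contradiction (≤-antisym 0≤1 1≤0) 0≉1
    where
    0≤-1 : 0# ≤ - 1#
    0≤-1 = ≤-respʳ-≈ (≈-trans (≈-sym (-‿distribʳ-* x (x ⁻¹))) (-‿cong (⁻¹-inverseʳ x x≉0)))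
                     (*-nonNegative 0≤x (x≤0⇒0≤-x x⁻¹≤0))

    1≤0 : 1# ≤ 0#
    1≤0 = ≤-respʳ-≈ (-‿inverseʳ 1#) (0≤y⇒x≤x+y 0≤-1)

  -- For `m` equal to 0 the factor `fromℕ m ⁻¹` is unspecified, so nonnegativity must come from `x`
  -- being `0#`.
  0≤x/m : ∀ {x} m → 0# ≤ x → (m ≡ 0 → x ≡ 0#) → 0# ≤ x * fromℕ m ⁻¹
  0≤x/m zero _ x≡0 rewrite x≡0 refl = ≤-reflexive (≈-sym (zeroˡ _))
  0≤x/m (suc m) 0≤x _ = *-nonNegative 0≤x (0≤x⁻¹ (0≤fromℕ (suc m)) (fromℕ[1+m]≉0 m))

-- Bounds for `MaxDist` and `MMSpan`.

module SpansProperties {c ℓ₁ ℓ₂ : Level} (F : OrderedField c ℓ₁ ℓ₂)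
                       {n : ℕ} (d : Fin n → Fin n → OrderedField.Carrier F) where
  open OrderedField F
  open OrderedFieldProperties F
  open Spans F d
  open Extrema totalOrder using (xs≤max; ⊥≤max; max≤v⁺; min≤⊤; min≤xs; v≤min⁺)

  x≤maximum : ∀ {x xs} → x ∈ˡ xs → x ≤ maximum xs
  x≤maximum {xs = x ∷ xs} (here refl) = ⊥≤max x xs
  x≤maximum {xs = x ∷ xs} (there y∈)  = All.lookup (xs≤max x xs) y∈

  maximum≤v : ∀ {v x xs} → x ∈ˡ xs → All (_≤ v) xs → maximum xs ≤ v
  maximum≤v {xs = _ ∷ _} _ (x≤v ∷ xs≤v) = max≤v⁺ x≤v xs≤v

  minimum≤x : ∀ {x xs} → x ∈ˡ xs → minimum xs ≤ x
  minimum≤x {xs = x ∷ xs} (here refl) = min≤⊤ x xs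
  minimum≤x {xs = x ∷ xs} (there y∈)  = All.lookup (min≤xs x xs) y∈

  v≤minimum : ∀ {v x xs} → x ∈ˡ xs → All (v ≤_) xs → v ≤ minimum xs
  v≤minimum {xs = _ ∷ _} _ (v≤x ∷ v≤xs) = v≤min⁺ v≤x v≤xs

  d≤MaxDist : ∀ {i x} {C : Subset n} → x ∈ C - i → d i x ≤ MaxDist i C
  d≤MaxDist {i} x∈ = x≤maximum (∈-map⁺ (d i) (∈-members⁺ x∈))

  MaxDist≤v : ∀ {i v} {C : Subset n} → Nonempty (C - i) → (∀ {x} → x ∈ C - i → d i x ≤ v) → MaxDist i C ≤ v
  MaxDist≤v {i} (x , x∈) d≤v =
    maximum≤v (∈-map⁺ (d i) (∈-members⁺ x∈)) (All.map⁺ (All.tabulate (d≤v ∘ ∈-members⁻)))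

  -- `C - i` has no members, so `maximum` takes its default value on the empty list.
  MaxDist-singleton : ∀ {i} {C : Subset n} → ∣ C ∣ ≡ 1 → i ∈ C → MaxDist i C ≡ 0#
  MaxDist-singleton {i} {C} ∣C∣≡1 i∈C =
    cong (maximum ∘ map (d i)) (filter-none (_∈? (C - i)) (All.universal x∉C-i (allFin n)))
    where
    x∉C-i : ∀ x → x ∉ C - i
    x∉C-i x x∈ = contradiction (begin-strict
      0                  ≤⟨ z≤n ⟩
      ∣ C - i - x ∣      <⟨ x∈p⇒∣p-x∣<∣p∣ x∈ ⟩
      ∣ C - i ∣          ≡⟨ ℕ.suc-injective (trans (x∈p⇒1+∣p-x∣≡∣p∣ i∈C) ∣C∣≡1) ⟩
      0                  ∎) λ ()
      where
      open ℕ.≤-Reasoning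

  MMSpan≤MaxDist : ∀ {i} {C : Subset n} → i ∈ C → MMSpan C ≤ MaxDist i C
  MMSpan≤MaxDist {C = C} i∈C = minimum≤x (∈-map⁺ (λ i → MaxDist i C) (∈-members⁺ i∈C))

  v≤MMSpan : ∀ {v} {C : Subset n} → Nonempty C → (∀ {i} → i ∈ C → v ≤ MaxDist i C) → v ≤ MMSpan C
  v≤MMSpan {C = C} (i , i∈C) v≤ =
    v≤minimum (∈-map⁺ (λ i → MaxDist i C) (∈-members⁺ i∈C)) (All.map⁺ (All.tabulate (v≤ ∘ ∈-members⁻)))

  -- The chain from `MMSpan C` through `MaxDist i* C` and `D` to `MMSpan C′` gives minimality; for
  -- `C′ = C` it closes up, which makes `i*` a centroid.
  best-and-centroid : ∀ {Nₒ m i*} {C : Subset n} D → C ⊆ Nₒ → ∣ C ∣ ≡ suc m → i* ∈ C → MaxDist i* C ≤ D →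
                      (∀ {i C′} → C′ ⊆ Nₒ → ∣ C′ ∣ ≡ suc m → i ∈ C′ → D ≤ MaxDist i C′) →
                      IsCbest Nₒ (suc m) C × IsMinMaxCentroid i* C
  best-and-centroid {Nₒ} {m} {i*} {C} D C⊆Nₒ ∣C∣≡ i*∈C MaxDist≤D D≤MaxDist =
    (C⊆Nₒ , ∣C∣≡ , λ C′ C′⊆Nₒ ∣C′∣≡ → ≤-trans MMSpan≤D (D≤MMSpan C′⊆Nₒ ∣C′∣≡)) ,
    (i*∈C , ≤-antisym (≤-trans MaxDist≤D (D≤MMSpan C⊆Nₒ ∣C∣≡)) (MMSpan≤MaxDist i*∈C))
    where
    MMSpan≤D : MMSpan C ≤ D
    MMSpan≤D = ≤-trans (MMSpan≤MaxDist i*∈C) MaxDist≤D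

    D≤MMSpan : ∀ {C′} → C′ ⊆ Nₒ → ∣ C′ ∣ ≡ suc m → D ≤ MMSpan C′
    D≤MMSpan {C′} C′⊆Nₒ ∣C′∣≡ =
      v≤MMSpan (0<∣p∣⇒Nonempty C′ (subst (0 <ℕ_) (sym ∣C′∣≡) (s≤s z≤n))) (D≤MaxDist C′⊆Nₒ ∣C′∣≡)

-- One iteration: sorted lists and Phase 1.

module IterationProperties
  {c ℓ₁ ℓ₂ : Level} (F : OrderedField c ℓ₁ ℓ₂)
  {n : ℕ} (d : Fin n → Fin n → OrderedField.Carrier F)
  (k G : ℕ) (lam Large : OrderedField.Carrier F)
  (order : Fin n → List (Fin n)) (ordering : ∀ i → Spans.IsOrdering F d i (order i))
  (k′ : ℕ) (σ : Method.State F d k G lam Large order) where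

  open OrderedField F
  open OrderedFieldProperties F
  open Spans F d
  open SpansProperties F d
  open Method F d k G lam Large order
  open Iteration (suc k′) σ
  open State σ

  Closer : Fin n → Rel (Fin n) ℓ₂
  Closer i j j′ = d i j ≤ d i j′

  available-sorted : ∀ i → AllPairs (Closer i) (available i)
  available-sorted i = AllPairs.filter⁺ (_∈? Nₒ) (Linked⇒AllPairs ≤-trans (proj₂ (ordering i)))

  order-unique : ∀ i → Unique (order i)
  order-unique i = Permutation.Unique-resp-↭ (setoid (Fin n)) (↭⇒↭ₛ (↭-sym (proj₁ (ordering i))))
                     (Unique.filter⁺ (λ j → ¬? (j Fin.≟ i)) (Unique.allFin⁺ n))

  i∉order : ∀ i → i ∉ˡ order i
  i∉order i i∈ = proj₂ (∈-filter⁻ (λ j → ¬? (j Fin.≟ i)) {xs = allFin n} (∈-resp-↭ (proj₁ (ordering i)) i∈)) refl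

  ∈-available : ∀ {i x} → x ∈ Nₒ - i → x ∈ˡ available i
  ∈-available {i} x∈ = ∈-filter⁺ (_∈? Nₒ)
    (∈-resp-↭ (↭-sym (proj₁ (ordering i)))
      (∈-filter⁺ (λ j → ¬? (j Fin.≟ i)) (∈-allFin _) (x∈p-y⇒x≢y {p = Nₒ} x∈)))
    (p─q⊆p Nₒ _ x∈)

  available⊆Nₒ : ∀ {i x} → x ∈ˡ available i → x ∈ Nₒ
  available⊆Nₒ {i} x∈ = proj₂ (∈-filter⁻ (_∈? Nₒ) {xs = order i} x∈)

  -- `Scan` points are already counted, so position `m` of the available points ahead is where the
  -- count reaches `MinScan`. The suffix kept in `fromS` still includes that point, hence `drop m`:
  -- Phase 2 examines it again.
  phase1Loop-stop : ∀ i m js v {j} → suc (Phase1Vars.Scan v +ℕ m) ≡ MinScan → filter (_∈? Nₒ) js [ m ]= j →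
                    Phase1Vars.Distance (phase1Loop i js v) ≡ d i j
                    × filter (_∈? Nₒ) (Phase1Vars.fromS (phase1Loop i js v)) ≡ drop m (filter (_∈? Nₒ) js)
  phase1Loop-stop i m (x ∷ js) v {j} eq q with x ∈? Nₒ
  phase1Loop-stop i m (x ∷ js) v {j} eq q | no _ = phase1Loop-stop i m js v eq q
  phase1Loop-stop i .0 (x ∷ js) v {j} eq here | yes x∈ =
    if-elim (λ r → Phase1Vars.Distance r ≡ d i j × filter (_∈? Nₒ) (Phase1Vars.fromS r) ≡ x ∷ filter (_∈? Nₒ) js)
      (suc (Phase1Vars.Scan v) ℕ.≟ MinScan)
      (λ _ → refl , filter-accept (_∈? Nₒ) x∈)
      (λ scan≢ → contradiction (trans (cong suc (sym (ℕ.+-identityʳ _))) eq) scan≢)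
  phase1Loop-stop i (suc m) (x ∷ js) v {j} eq (there q) | yes x∈ =
    if-elim (λ r → Phase1Vars.Distance r ≡ d i j × filter (_∈? Nₒ) (Phase1Vars.fromS r) ≡ drop m (filter (_∈? Nₒ) js))
      (suc (Phase1Vars.Scan v) ℕ.≟ MinScan)
      (λ scan≡ → contradiction (ℕ.suc-injective (trans scan≡ (sym eq))) (ℕ.m+1+n≢m _ ∘ sym))
      (λ _ → phase1Loop-stop i m js _ (trans (cong suc (sym (ℕ.+-suc _ m))) eq) q)

  -- What makes `TargetGap` nonnegative. `SumGap≡0` serves the case in which the divisor in
  -- `BestMeanGap` is zero.
  record NonNegativeGaps (v : Phase1Vars) : Set (c ⊔ ℓ₂) where
    open Phase1Vars v
    field
      0≤MinGap : 0# ≤ MinGap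
      0≤SumGap : 0# ≤ SumGap
      SumGap≡0 : MinScan ∸ 1 ≡ 0 → SumGap ≡ 0#

  -- In a sorted list consecutive distances do not decrease. The premise on `PreviousDistance`
  -- starts with the second visit, since before the first one it holds a placeholder.
  phase1Loop-gaps : ∀ i js v → AllPairs (Closer i) (filter (_∈? Nₒ) js) →
                    (1 <ℕ suc (Phase1Vars.Scan v) →
                      All (λ j → Phase1Vars.PreviousDistance v ≤ d i j) (filter (_∈? Nₒ) js)) →
                    Phase1Vars.Scan v <ℕ MinScan →
                    NonNegativeGaps v → NonNegativeGaps (phase1Loop i js v)
  phase1Loop-gaps i []       v _ _ _ gaps = gaps
  phase1Loop-gaps i (x ∷ js) v sorted prev< scan< gaps with x ∈? Nₒ
  ... | no  _ = phase1Loop-gaps i js v sorted prev< scan< gaps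
  phase1Loop-gaps i (x ∷ js) v (x≤ ∷ sorted) prev< scan< gaps | yes _ =
    if-elim NonNegativeGaps (suc Scan ℕ.≟ MinScan)
      (λ _ → visited)
      (λ scan≢ → phase1Loop-gaps i js _ sorted (λ _ → x≤) (ℕ.≤∧≢⇒< scan< scan≢) visited)
    where
    open Phase1Vars v
    open NonNegativeGaps gaps
    open NaturalMin totalOrder using (⊓-glb)

    0≤Gap : 1 <ℕ suc Scan → 0# ≤ d i x − PreviousDistance
    0≤Gap 1<scan = x≤y⇒0≤y−x (All.head (prev< 1<scan))

    visited : ∀ {D P s} →
              NonNegativeGaps (record (phase1Visit i x v) { Distance = D ; PreviousDistance = P ; fromS = s })
    visited = record
      { 0≤MinGap = if-elim (0# ≤_) (1 ℕ.<? suc Scan) (λ 1<scan → ⊓-glb (0≤Gap 1<scan) 0≤MinGap) (λ _ → 0≤MinGap)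
      ; 0≤SumGap = if-elim (0# ≤_) (1 ℕ.<? suc Scan) (λ 1<scan → 0≤x+y 0≤SumGap (0≤Gap 1<scan)) (λ _ → 0≤SumGap)
      ; SumGap≡0 = λ MinScan≡1 → if-elim (_≡ 0#) (1 ℕ.<? suc Scan)
          -- A gap arises only from the second visit on, which requires `MinScan` to be at least 2.
          (λ 1<scan → contradiction MinScan≡1 (ℕ.m>n⇒m∸n≢0 (ℕ.<-≤-trans 1<scan scan<)))
          (λ _ → SumGap≡0 MinScan≡1)
      }

  phase1-gaps : ∀ i → 0# ≤ Large → 0 <ℕ MinScan → NonNegativeGaps (phase1 i)
  phase1-gaps i 0≤Large 0<MinScan =
    phase1Loop-gaps i (order i) phase1Init (available-sorted i) (λ { (s≤s ()) }) 0<MinScan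
    record { 0≤MinGap = 0≤Large ; 0≤SumGap = ≤-refl ; SumGap≡0 = λ _ → refl }

  -- Phase 2: the scan of one list.

  record Scanned (i : Fin n) (xs : List (Fin n)) (S : ℕ) (D : Carrier) (r : ℕ × Carrier) : Set (c ⊔ ℓ₁ ⊔ ℓ₂) where
    T = proj₁ r
    E = proj₂ r
    field
      bounded : T ≤ℕ MaxScan
      -- Position `u` of `xs`, once accepted, brings the count to `suc (S +ℕ u)`; the first
      -- alternative means that no point was accepted.
      last    : (T ≡ S × E ≡ D)
                ⊎ ∃₂ λ u j → T ≡ suc (S +ℕ u) × xs [ u ]= j × E ≡ d i j × d i j ≤ DistanceLimit
      maximal : ∀ {u j} → S +ℕ u <ℕ MaxScan → xs [ u ]= j → d i j ≤ DistanceLimit → S +ℕ u <ℕ T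

  -- A scan ends at the end of the list, at `MaxScan`, or at a point beyond `DistanceLimit`; in the
  -- last case sortedness puts all later points beyond it as well, so `maximal` holds.
  phase2Loop-scanned : ∀ i js S D → S <ℕ MaxScan → AllPairs (Closer i) (filter (_∈? Nₒ) js) →
                       Scanned i (filter (_∈? Nₒ) js) S D (phase2Loop i js (S , D))
  phase2Loop-scanned i [] S D S< _ = record { bounded = ℕ.<⇒≤ S< ; last = inj₁ (refl , refl) ; maximal = λ _ () }
  phase2Loop-scanned i (x ∷ js) S D S< sorted with x ∈? Nₒ
  ... | no _ = phase2Loop-scanned i js S D S< sorted
  phase2Loop-scanned i (x ∷ js) S D S< (x≤ ∷ sorted) | yes _ =
    if-elim (Scanned i xs S D) (DistanceLimit <? d i x) beyond
      (λ DL≮ → if-elim (Scanned i xs S D) (suc S ℕ.≟ MaxScan)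
        (full (≮⇒≥ DL≮))
        (λ S+1≢ → extend (≮⇒≥ DL≮) (phase2Loop-scanned i js (suc S) (d i x) (ℕ.≤∧≢⇒< S< S+1≢) sorted)))
    where
    xs = x ∷ filter (_∈? Nₒ) js

    beyond : DistanceLimit < d i x → Scanned i xs S D (S , D)
    beyond DL<dx = record
      { bounded = ℕ.<⇒≤ S<
      ; last    = inj₁ (refl , refl)
      ; maximal = λ _ q dj≤DL →
          contradiction (≤-trans ([]=-mono {R = Closer i} ≤-refl (x≤ ∷ sorted) z≤n here q) dj≤DL) (<⇒≱ DL<dx)
      }

    full : d i x ≤ DistanceLimit → suc S ≡ MaxScan → Scanned i xs S D (suc S , d i x)
    full dx≤DL S+1≡ = record
      { bounded = S<
      ; last    = inj₂ (0 , x , cong suc (sym (ℕ.+-identityʳ S)) , here , refl , dx≤DL)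
      ; maximal = λ {u} S+u< _ _ → subst (S +ℕ u <ℕ_) (sym S+1≡) S+u<
      }

    extend : ∀ {r} → d i x ≤ DistanceLimit → Scanned i (filter (_∈? Nₒ) js) (suc S) (d i x) r → Scanned i xs S D r
    extend {r} dx≤DL rest = record
      { bounded = bounded
      ; last    = inj₂ ([ (λ { (T≡ , E≡) → 0 , x , trans T≡ (cong suc (sym (ℕ.+-identityʳ S))) , here , E≡ , dx≤DL })
                        , (λ { (u , j , T≡ , q , E≡ , dj≤DL) →
                                 suc u , j , trans T≡ (cong suc (sym (ℕ.+-suc S u))) , there q , E≡ , dj≤DL }) ]′ last)
      ; maximal = maximal′
      }
      where
      open Scanned rest
      S<T : S <ℕ proj₁ r
      S<T = [ (λ { (T≡ , _) → ℕ.≤-reflexive (sym T≡) })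
            , (λ { (u , _ , T≡ , _) → ℕ.≤-trans (ℕ.m≤n⇒m≤1+n (ℕ.m≤m+n (suc S) u)) (ℕ.≤-reflexive (sym T≡)) }) ]′ last

      maximal′ : ∀ {u j} → S +ℕ u <ℕ MaxScan → xs [ u ]= j → d i j ≤ DistanceLimit → S +ℕ u <ℕ proj₁ r
      maximal′ _ here _ = subst (_<ℕ proj₁ r) (sym (ℕ.+-identityʳ S)) S<T
      maximal′ {suc u} S+u< (there q) dj≤DL =
        subst (_<ℕ proj₁ r) (sym (ℕ.+-suc S u)) (maximal (subst (_<ℕ MaxScan) (ℕ.+-suc S u) S+u<) q dj≤DL)

  -- Phase 2: comparison of the points.

  scan : Fin n → ℕ
  scan i = proj₁ (phase2 i)

  reach : Fin n → Carrier
  reach i = proj₂ (phase2 i)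

  found : Fin n → Phase2Best
  found i = record { centre = just i ; BestScan = scan i ; BestDistance = reach i }

  Better : Phase2Best → Fin n → Set (ℓ₁ ⊔ ℓ₂)
  Better b i = MinScan ≤ℕ scan i × (BestScan <ℕ scan i ⊎ scan i ≡ BestScan × reach i < BestDistance)
    where
    open Phase2Best b

  phase2Update-elim : ∀ (P : Phase2Best → Set p) b i →
                      (Better b i → P (found i)) → (¬ Better b i → P b) → P (phase2Update b i)
  phase2Update-elim P b i = if-elim P
    ((MinScan ℕ.≤? scan i)
     ×-dec ((BestScan ℕ.<? scan i) ⊎-dec ((scan i ℕ.≟ BestScan) ×-dec (reach i <? BestDistance))))
    where
    open Phase2Best b

  -- The weak form of the lexicographic order in which Phase 2 compares points: larger count first,
  -- then smaller distance.
  Dominates : Phase2Best → Fin n → Set ℓ₂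
  Dominates b i = MinScan ≤ℕ scan i → scan i <ℕ BestScan ⊎ scan i ≡ BestScan × BestDistance ≤ reach i
    where
    open Phase2Best b

  phase2Update-dominates : ∀ b i → Dominates (phase2Update b i) i
  phase2Update-dominates b i =
    phase2Update-elim (λ b′ → Dominates b′ i) b i (λ _ _ → inj₂ (refl , ≤-refl)) rejected
    where
    open Phase2Best b
    rejected : ¬ Better b i → Dominates b i
    rejected ¬better M≤ with ℕ.<-cmp (scan i) BestScan
    ... | tri< T<B _ _ = inj₁ T<B
    ... | tri≈ _ T≡B _ = inj₂ (T≡B , ≮⇒≥ λ E<B → ¬better (M≤ , inj₂ (T≡B , E<B)))
    ... | tri> _ _ B<T = contradiction (M≤ , inj₁ B<T) ¬better

  -- Transitivity of the lexicographic order, by cases on whether count or distance decides each of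
  -- the two comparisons.
  phase2Update-keeps : ∀ b i i′ → Dominates b i′ → Dominates (phase2Update b i) i′
  phase2Update-keeps b i i′ dominated = phase2Update-elim (λ b′ → Dominates b′ i′) b i replaced (λ _ → dominated)
    where
    replaced : Better b i → Dominates (found i) i′
    replaced (_ , better) M≤ with better | dominated M≤
    ... | inj₁ B<T          | inj₁ T′<B          = inj₁ (ℕ.<-trans T′<B B<T)
    ... | inj₁ B<T          | inj₂ (T′≡B , _)    = inj₁ (subst (_<ℕ scan i) (sym T′≡B) B<T)
    ... | inj₂ (T≡B , _)    | inj₁ T′<B          = inj₁ (subst (scan i′ <ℕ_) (sym T≡B) T′<B)
    ... | inj₂ (T≡B , E<B)  | inj₂ (T′≡B , B≤E′) = inj₂ (trans T′≡B (sym T≡B) , ≤-trans (proj₁ E<B) B≤E′)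

  phase2Best-dominates : ∀ {i} → i ∈ Nₒ → Dominates phase2Best i
  phase2Best-dominates i∈ =
    foldl-absorbs Dominates phase2Update-dominates phase2Update-keeps (members Nₒ) (∈-members⁺ i∈)

  -- `some` identifies the whole record, so that count and distance belong to the same point. `none`
  -- retains the initial `BestScan`, which for positive `MinScan` is too small to dominate a point
  -- that reaches `MinScan`.
  data Recorded (b : Phase2Best) : Set c where
    none : Phase2Best.centre b ≡ nothing → Phase2Best.BestScan b ≡ MinScan ∸ 1 → Recorded b
    some : ∀ {i} → i ∈ Nₒ → MinScan ≤ℕ scan i → b ≡ found i → Recorded b

  phase2Best-recorded : Recorded phase2Best
  phase2Best-recorded = foldl-preserves Recorded (members Nₒ)
    (λ b i i∈ recorded →
      phase2Update-elim Recorded b i (λ { (M≤ , _) → some (∈-members⁻ i∈) M≤ refl }) (λ _ → recorded))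
    (none refl refl)

  -- Moving points into the cluster.

  record Moved (m : ℕ) (js xs : List (Fin n)) (N C : Subset n) (r : Subset n × Subset n) : Set where
    N′ = proj₁ r
    C′ = proj₂ r
    field
      remaining : ∣ N′ ∣ +ℕ m ≡ ∣ N ∣
      size      : ∣ C′ ∣ ≡ m +ℕ ∣ C ∣
      source    : ∀ {x} → x ∈ C′ → x ∈ C ⊎ ∃[ u ] (u <ℕ m × xs [ u ]= x)
      -- Applied to `i*`: it is missing from its own list, so it stays available until it is moved
      -- separately.
      untouched : ∀ {x} → x ∈ N → x ∉ˡ js → x ∈ N′

  -- The bound on `m` keeps the list from running out before `m` moves, and disjointness of `C` and
  -- `N` makes each move enlarge `C`.
  moveFirst-moved : ∀ m js N C → Unique js → m ≤ℕ length (filter (_∈? N) js) → (∀ {x} → x ∈ C → x ∉ N) →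
                    Moved m js (filter (_∈? N) js) N C (moveFirst m js (N , C))
  moveFirst-moved zero js N C _ _ _ =
    record { remaining = ℕ.+-identityʳ _ ; size = refl ; source = inj₁ ; untouched = λ x∈N _ → x∈N }
  moveFirst-moved (suc m) (j ∷ js) N C (j≢ ∷ unique) m≤ disjoint with j ∈? N
  ... | no _ = record { Moved rest ; untouched = λ x∈N x∉ → Moved.untouched rest x∈N (x∉ ∘ there) }
    where rest = moveFirst-moved (suc m) js N C unique m≤ disjoint
  ... | yes j∈N = record
    { remaining = trans (ℕ.+-suc _ m) (trans (cong suc remaining) (x∈p⇒1+∣p-x∣≡∣p∣ j∈N))
    ; size      = trans size (trans (cong (m +ℕ_) (x∉p⇒∣p∪⁅x⁆∣≡1+∣p∣ j∉C)) (ℕ.+-suc m _))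
    ; source    = source′
    ; untouched = λ x∈N x∉ → untouched (x∈p∧x≢y⇒x∈p-y x∈N (x∉ ∘ here)) (x∉ ∘ there)
    }
    where
    j∉C : j ∉ C
    j∉C j∈C = disjoint j∈C j∈N

    same : filter (_∈? (N - j)) js ≡ filter (_∈? N) js
    same = filter-remove N js λ j∈ → All.lookup j≢ j∈ refl

    disjoint′ : ∀ {x} → x ∈ C ∪ ⁅ j ⁆ → x ∉ N - j
    disjoint′ x∈ x∈N-j with x∈p∪q⁻ C ⁅ j ⁆ x∈
    ... | inj₁ x∈C = disjoint x∈C (p─q⊆p N _ x∈N-j)
    ... | inj₂ x∈j = x∈p-y⇒x≢y {p = N} x∈N-j (x∈⁅y⁆⇒x≡y _ x∈j)

    rest = moveFirst-moved m js (N - j) (C ∪ ⁅ j ⁆) unique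
             (subst (λ l → m ≤ℕ length l) (sym same) (s≤s⁻¹ m≤)) disjoint′

    open Moved rest using (remaining; size; source; untouched)

    source′ : ∀ {x} → x ∈ proj₂ (moveFirst m js (N - j , C ∪ ⁅ j ⁆)) →
              x ∈ C ⊎ ∃[ u ] (u <ℕ suc m × (j ∷ filter (_∈? N) js) [ u ]= x)
    source′ x∈ with source x∈
    ... | inj₂ (u , u<m , q) = inj₂ (suc u , s≤s u<m , there (subst (_[ u ]= _) same q))
    ... | inj₁ x∈C∪j with x∈p∪q⁻ C ⁅ j ⁆ x∈C∪j
    ...   | inj₁ x∈C = inj₁ x∈C
    ...   | inj₂ x∈j = inj₂ (0 , s≤s z≤n , subst (_ [ 0 ]=_) (sym (x∈⁅y⁆⇒x≡y _ x∈j)) here)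

  -- Size limits and the data of a choice.

  module _ (1≤G : 1 ≤ℕ G) (feasible : Feasible G (suc k′) Nₒ nₒ) where

    nₒ≡∣Nₒ∣ : nₒ ≡ ∣ Nₒ ∣
    nₒ≡∣Nₒ∣ = proj₁ feasible

    G+Gk′≤nₒ : G +ℕ G *ℕ k′ ≤ℕ nₒ
    G+Gk′≤nₒ = subst (_≤ℕ nₒ) (ℕ.*-suc G k′) (proj₂ feasible)

    G≤MaxSize : G ≤ℕ MaxSize
    G≤MaxSize = ℕ.m+n≤o⇒m≤o∸n G G+Gk′≤nₒ

    1+MaxScan≡MaxSize : suc MaxScan ≡ MaxSize
    1+MaxScan≡MaxSize = ℕ.m+[n∸m]≡n (ℕ.≤-trans 1≤G G≤MaxSize)

    MaxScan<∣Nₒ∣ : MaxScan <ℕ ∣ Nₒ ∣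
    MaxScan<∣Nₒ∣ = ℕ.≤-trans (ℕ.≤-reflexive 1+MaxScan≡MaxSize)
                             (subst (MaxSize ≤ℕ_) nₒ≡∣Nₒ∣ (ℕ.m∸n≤m nₒ (G *ℕ k′)))

    -- `nₒ` is `MaxSize +ℕ G *ℕ k′` and `G ≤ MaxSize`, so `suc k′` clusters of size `MaxSize` would
    -- cover all points; the ceiling `MinSize` is thus at most `MaxSize`.
    MinScan≤MaxScan : MinScan ≤ℕ MaxScan
    MinScan≤MaxScan = ℕ.∸-monoˡ-≤ 1 (⌈/⌉-≤ {k = k′} {b = MaxSize} (begin
      nₒ                       ≡⟨ ℕ.m∸n+n≡m (ℕ.≤-trans (ℕ.m≤n+m _ G) G+Gk′≤nₒ) ⟨
      MaxSize +ℕ G *ℕ k′       ≤⟨ ℕ.+-monoʳ-≤ MaxSize (ℕ.*-monoˡ-≤ k′ G≤MaxSize) ⟩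
      MaxSize +ℕ MaxSize *ℕ k′ ≡⟨ ℕ.*-suc MaxSize k′ ⟨
      MaxSize *ℕ suc k′        ∎))
      where
      open ℕ.≤-Reasoning

    -- `MinSize ≤ 1` means `nₒ ≤ suc k′`; since at least one point is reserved for each of the other
    -- `k′` clusters, at most one is left.
    MinScan≡0⇒MaxScan≡0 : MinScan ≡ 0 → MaxScan ≡ 0
    MinScan≡0⇒MaxScan≡0 MinScan≡0 = ℕ.m≤n⇒m∸n≡0 (begin
      nₒ ∸ G *ℕ k′       ≤⟨ ℕ.∸-mono (⌈/⌉-≥ {b = 1} (ℕ.m∸n≡0⇒m≤n MinScan≡0)) (ℕ.*-monoˡ-≤ k′ 1≤G) ⟩
      1 *ℕ suc k′ ∸ 1 *ℕ k′ ≡⟨ cong (_∸ 1 *ℕ k′) (ℕ.*-suc 1 k′) ⟩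
      1 +ℕ 1 *ℕ k′ ∸ 1 *ℕ k′ ≡⟨ ℕ.m+n∸n≡m 1 (1 *ℕ k′) ⟩
      1                  ∎)
      where
      open ℕ.≤-Reasoning

    -- `radius` stands for d(i*, j_b), and for `0#` when `b` is 0. It bounds the generated cluster
    -- from above by `within` and every competitor from below by `optimal`.
    record Choice (i* : Fin n) (b : ℕ) : Set (c ⊔ ℓ₁ ⊔ ℓ₂) where
      field
        i*∈Nₒ       : i* ∈ Nₒ
        b≤MaxScan   : b ≤ℕ MaxScan
        b≤available : b ≤ℕ length (available i*)
        largest     : IsLargestAdmissible i* (suc b)
        radius      : Carrier
        radius≡0    : b ≡ 0 → radius ≡ 0#
        within      : ∀ {u x} → u <ℕ b → available i* [ u ]= x → d i* x ≤ radius
        optimal     : ∀ {i C} → C ⊆ Nₒ → ∣ C ∣ ≡ suc b → i ∈ C → radius ≤ MaxDist i C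

    -- Only size 1 is admissible, and every one-point cluster has `MaxDist` equal to `0#`, so any
    -- available point will do.
    choice-alone : ∀ {i} → MinScan ≡ 0 → i ∈ Nₒ → Choice i 0
    choice-alone {i} MinScan≡0 i∈ = record
      { i*∈Nₒ       = i∈
      ; b≤MaxScan   = z≤n
      ; b≤available = z≤n
      ; largest     = one , λ i′ _ _ → size≤1
      ; radius      = 0#
      ; radius≡0    = λ _ → refl
      ; within      = λ ()
      ; optimal     = λ _ ∣C∣≡1 i∈C → ≤-reflexive (≈.reflexive (sym (MaxDist-singleton ∣C∣≡1 i∈C)))
      }
      where
      size≤1 : ∀ {i v} → Admissible i v → v ≤ℕ 1
      size≤1 one           = ℕ.≤-refl
      size≤1 (more {m} v≤ _ _) = subst (λ b → suc (suc m) ≤ℕ suc b) (MinScan≡0⇒MaxScan≡0 MinScan≡0) v≤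

    -- The counting lemma gives existence: `Nₒ - i` has at least `MaxScan` points, all of them
    -- listed.
    available-position : ∀ {i} → i ∈ Nₒ → ∀ {m} → m <ℕ MaxScan → ∃ λ j → available i [ m ]= j
    available-position {i} i∈ {m} m<MaxScan =
      let j , _ , q , _ = ∃-late-member {R = Closer i} ≤-refl (available i) (available-sorted i) (Nₒ - i)
                            ∈-available (ℕ.<-≤-trans m<MaxScan MaxScan≤)
      in  j , q
      where
      MaxScan≤ : MaxScan ≤ℕ ∣ Nₒ - i ∣
      MaxScan≤ = s≤s⁻¹ (subst (MaxScan <ℕ_) (sym (x∈p⇒1+∣p-x∣≡∣p∣ i∈)) MaxScan<∣Nₒ∣)

    -- The choice made by Phase 2.

    module _ (0<MinScan : 0 <ℕ MinScan) where

      1+m₀≡MinScan : suc (MinScan ∸ 1) ≡ MinScan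
      1+m₀≡MinScan = ℕ.m+[n∸m]≡n 0<MinScan

      phase1-distance : ∀ {i} → i ∈ Nₒ →
                        ∃ λ j → available i [ MinScan ∸ 1 ]= j × Phase1Vars.Distance (phase1 i) ≡ d i j
      phase1-distance {i} i∈ =
        let j , q = available-position i∈ (ℕ.≤-trans (ℕ.≤-reflexive 1+m₀≡MinScan) MinScan≤MaxScan)
        in  j , q , proj₁ (phase1Loop-stop i _ (order i) phase1Init 1+m₀≡MinScan q)

      -- As many points are dropped as the initial count `MinScan ∸ 1`, so `S +ℕ u` in `Scanned` is
      -- a position in the whole list `available i`.
      phase2-scanned : ∀ {i} → i ∈ Nₒ →
                       Scanned i (drop (MinScan ∸ 1) (available i)) (MinScan ∸ 1)
                               (Phase1Vars.Distance (phase1 i)) (phase2 i)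
      phase2-scanned {i} i∈ =
        subst (λ xs → Scanned i xs (MinScan ∸ 1) (Phase1Vars.Distance (phase1 i)) (phase2 i)) start≡
          (phase2Loop-scanned i (Phase1Vars.fromS (phase1 i)) _ _ m₀<MaxScan
            (subst (AllPairs (Closer i)) (sym start≡) (AllPairs.drop⁺ (MinScan ∸ 1) (available-sorted i))))
        where
        m₀<MaxScan : MinScan ∸ 1 <ℕ MaxScan
        m₀<MaxScan = ℕ.≤-trans (ℕ.≤-reflexive 1+m₀≡MinScan) MinScan≤MaxScan

        start≡ = proj₂ (phase1Loop-stop i _ (order i) phase1Init 1+m₀≡MinScan (proj₂ (available-position i∈ m₀<MaxScan)))

      scan≤MaxScan : ∀ {i} → i ∈ Nₒ → scan i ≤ℕ MaxScan
      scan≤MaxScan = Scanned.bounded ∘ phase2-scanned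

      scan-last : ∀ {i} → i ∈ Nₒ → MinScan ≤ℕ scan i →
                  ∃₂ λ t j → scan i ≡ suc t × available i [ t ]= j × reach i ≡ d i j × d i j ≤ DistanceLimit
      scan-last {i} i∈ M≤ with Scanned.last (phase2-scanned i∈)
      -- A scan without accepted points would leave the count at `MinScan ∸ 1`, below `MinScan`.
      ... | inj₁ (T≡m₀ , _) =
        contradiction (ℕ.≤-trans (ℕ.≤-reflexive 1+m₀≡MinScan) (subst (MinScan ≤ℕ_) T≡m₀ M≤)) ℕ.1+n≰n
      ... | inj₂ (u , j , T≡ , q , E≡ , dj≤) = MinScan ∸ 1 +ℕ u , j , T≡ , []=-drop⁻ (MinScan ∸ 1) _ q , E≡ , dj≤

      scan-maximal : ∀ {i t j} → i ∈ Nₒ → MinScan ≤ℕ suc t → t <ℕ MaxScan →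
                     available i [ t ]= j → d i j ≤ DistanceLimit → t <ℕ scan i
      scan-maximal {i} {t} i∈ M≤ t< q dj≤ =
        subst (_<ℕ scan i) t≡ (Scanned.maximal (phase2-scanned i∈) (subst (_<ℕ MaxScan) (sym t≡) t<)
          ([]=-drop⁺ (MinScan ∸ 1) _ (subst (available i [_]= _) (sym t≡) q)) dj≤)
        where
        -- The premise on `MinScan` places `t` within the suffix that Phase 2 scans.
        t≡ : MinScan ∸ 1 +ℕ (t ∸ (MinScan ∸ 1)) ≡ t
        t≡ = ℕ.m+[n∸m]≡n (s≤s⁻¹ (subst (_≤ℕ suc t) (sym 1+m₀≡MinScan) M≤))

      -- With `b = suc t` the point `j` is j_b of `i`. Domination bounds all counts, which settles
      -- the largest size, and at equal counts compares distances, which settles optimality.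
      choice-best : ∀ {i t j} → i ∈ Nₒ → MinScan ≤ℕ suc t → suc t ≤ℕ MaxScan →
                    available i [ t ]= j → d i j ≤ DistanceLimit →
                    (∀ {i′} → i′ ∈ Nₒ → MinScan ≤ℕ scan i′ →
                      scan i′ <ℕ suc t ⊎ scan i′ ≡ suc t × d i j ≤ reach i′) →
                    Choice i (suc t)
      choice-best {i} {t} {j} i∈ M≤ t< q dj≤ dominates = record
        { i*∈Nₒ       = i∈
        ; b≤MaxScan   = t<
        ; b≤available = []=⇒< q
        ; largest     = more (s≤s t<) ([]=⇒< q)
                            (subst (λ x → d i x ≤ DistanceLimit) (sym ([]=⇒lookup q ([]=⇒< q))) dj≤)
                      , λ i′ i′∈ v′ → largest i′∈
        ; radius      = d i j
        ; radius≡0    = λ ()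
        ; within      = λ { (s≤s u≤t) p → []=-mono {R = Closer i} ≤-refl (available-sorted i) u≤t p q }
        ; optimal     = optimal
        }
        where
        scan≤ : ∀ {i′} → i′ ∈ Nₒ → MinScan ≤ℕ scan i′ → scan i′ ≤ℕ suc t
        scan≤ i′∈ M≤T′ = [ ℕ.<⇒≤ , ℕ.≤-reflexive ∘ proj₁ ]′ (dominates i′∈ M≤T′)

        largest : ∀ {i′ v′} → i′ ∈ Nₒ → Admissible i′ v′ → v′ ≤ℕ suc (suc t)
        largest i′∈ one = s≤s z≤n
        largest {i′} i′∈ (more {m} v≤ m< dm≤) with ℕ.≤-total m t
        ... | inj₁ m≤t = s≤s (s≤s m≤t)
        -- Position `m` is within the limit, so Phase 2 counts it, and domination bounds the count
        -- of `i′` by `suc t`.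
        ... | inj₂ t≤m = s≤s (ℕ.≤-trans m<T′ (scan≤ i′∈ (ℕ.≤-trans M≤m m<T′)))
          where
          M≤m  = ℕ.≤-trans M≤ (s≤s t≤m)
          m<T′ = scan-maximal i′∈ M≤m (s≤s⁻¹ v≤) ([]=-lookup (available i′) m<) dm≤

        -- If `y` is beyond `DistanceLimit`, it is no nearer than `j`. Otherwise Phase 2 counts it,
        -- so domination makes the count of `i′` exactly `suc t` and `reach i′` the distance at
        -- position `t`.
        closest : ∀ {i′ y} → i′ ∈ Nₒ → available i′ [ t ]= y → d i j ≤ d i′ y
        closest {i′} {y} i′∈ q′ with ≤-total (d i′ y) DistanceLimit
        ... | inj₂ DL≤ = ≤-trans dj≤ DL≤
        ... | inj₁ dy≤DL with scan-maximal i′∈ M≤ t< q′ dy≤DL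
        ...   | t<T′ with dominates i′∈ (ℕ.≤-trans M≤ t<T′)
        ...     | inj₁ T′<1+t = contradiction t<T′ (ℕ.<⇒≱ T′<1+t)
        ...     | inj₂ (T′≡ , dj≤E′) with scan-last i′∈ (ℕ.≤-trans M≤ t<T′)
        ...       | t′ , j′ , T′≡1+t′ , qj′ , E′≡ , _ =
          -- `t′` equals `t`; monotonicity at equal positions spares the identification of `j′` with
          -- `y`.
          ≤-trans dj≤E′ (≤-trans (≤-reflexive (≈.reflexive E′≡))
            ([]=-mono {R = Closer i′} ≤-refl (available-sorted i′)
              (ℕ.≤-reflexive (ℕ.suc-injective (trans (sym T′≡1+t′) T′≡))) qj′ q′))

        optimal : ∀ {i′ C} → C ⊆ Nₒ → ∣ C ∣ ≡ suc (suc t) → i′ ∈ C → d i j ≤ MaxDist i′ C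
        optimal {i′} {C} C⊆Nₒ ∣C∣≡ i′∈C =
          -- `C - i′` has `suc t` points, too many to lie all before position `t`.
          let y , x , q′ , x∈ , dy≤dx =
                ∃-late-member {R = Closer i′} ≤-refl (available i′) (available-sorted i′) (C - i′)
                  (λ x∈ → ∈-available (x∈p∧x≢y⇒x∈p-y (C⊆Nₒ (p─q⊆p C _ x∈)) (x∈p-y⇒x≢y {p = C} x∈)))
                  (ℕ.≤-reflexive (sym (ℕ.suc-injective (trans (x∈p⇒1+∣p-x∣≡∣p∣ i′∈C) ∣C∣≡))))
          in  ≤-trans (closest (C⊆Nₒ i′∈C) q′) (≤-trans dy≤dx (d≤MaxDist x∈))

      choice-phase2 : ∀ {i} → Phase2Best.centre phase2Best ≡ just i → Choice i (Phase2Best.BestScan phase2Best)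
      -- `phase2Best` is generalised together with its two properties, so that matching on `some`
      -- turns it into `found i` in all of them.
      choice-phase2 {i} centre≡ with phase2Best | phase2Best-recorded | (λ {i′} (i′∈ : i′ ∈ Nₒ) → phase2Best-dominates i′∈)
      ... | b | none centre≡nothing _ | dom = contradiction (trans (sym centre≡) centre≡nothing) λ ()
      choice-phase2 refl | _ | some {i} i∈ M≤ refl | dom with scan-last i∈ M≤
      ... | t , j , T≡ , q , E≡ , dj≤ =
        subst (Choice i) (sym T≡) (choice-best i∈ (subst (MinScan ≤ℕ_) T≡ M≤)
          (subst (_≤ℕ MaxScan) T≡ (scan≤MaxScan i∈)) q dj≤
          λ {i′} i′∈ M≤′ → subst₂ (λ b D → scan i′ <ℕ b ⊎ scan i′ ≡ b × D ≤ reach i′) T≡ E≡ (dom i′∈ M≤′))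

    choose-choice : ∀ {i* b} → choose ≡ just (i* , b) → Choice i* b
    choose-choice {i*} {b} = if-elim (λ chosen → chosen ≡ just (i* , b) → Choice i* b) (MinScan ℕ.≟ 0)
      (λ MinScan≡0 eq → case map-just⁻ (head (members Nₒ)) eq of λ
        { (_ , head≡ , refl) → choice-alone MinScan≡0 (∈-members⁻ (head⇒∈ (members Nₒ) head≡)) })
      (λ MinScan≢0 eq → case map-just⁻ (Phase2Best.centre phase2Best) eq of λ
        { (_ , centre≡ , refl) → choice-phase2 (ℕ.n≢0⇒n>0 MinScan≢0) centre≡ })

    -- The generated cluster and the next state.

    module _ {i* : Fin n} {b : ℕ} (choice : Choice i* b) where
      open Choice choice
      open Outcome (generate (i* , b)) using (cluster; next)

      open Moved (moveFirst-moved b (order i*) Nₒ _ (order-unique i*) b≤available (⊥-elim ∘ ∉⊥))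

      moved-position : ∀ {x} → x ∈ C′ → ∃[ u ] (u <ℕ b × available i* [ u ]= x)
      moved-position = [ ⊥-elim ∘ ∉⊥ , id ]′ ∘ source

      i*∉moved : i* ∉ C′
      i*∉moved i*∈ with u , _ , q ← moved-position i*∈ =
        i∉order i* (proj₁ (∈-filter⁻ (_∈? Nₒ) {xs = order i*} ([]=⇒∈ q)))

      ∣cluster∣≡1+b : ∣ cluster ∣ ≡ suc b
      ∣cluster∣≡1+b = begin
        ∣ cluster ∣        ≡⟨ x∉p⇒∣p∪⁅x⁆∣≡1+∣p∣ i*∉moved ⟩
        suc ∣ C′ ∣         ≡⟨ cong suc size ⟩
        suc (b +ℕ _)       ≡⟨ cong (λ m → suc (b +ℕ m)) (∣⊥∣≡0 n) ⟩
        suc (b +ℕ 0)       ≡⟨ cong suc (ℕ.+-identityʳ b) ⟩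
        suc b              ∎
        where
        open ≡-Reasoning

      cluster⊆Nₒ : cluster ⊆ Nₒ
      cluster⊆Nₒ x∈ with x∈p∪q⁻ C′ ⁅ i* ⁆ x∈
      ... | inj₂ x∈i* = subst (_∈ Nₒ) (sym (x∈⁅y⁆⇒x≡y i* x∈i*)) i*∈Nₒ
      ... | inj₁ x∈C′ = available⊆Nₒ ([]=⇒∈ (proj₂ (proj₂ (moved-position x∈C′))))

      i*∈cluster : i* ∈ cluster
      i*∈cluster = x∈p∪q⁺ (inj₂ (x∈⁅x⁆ i*))

      d≤radius : ∀ {x} → x ∈ cluster - i* → d i* x ≤ radius
      d≤radius x∈ with x∈p∪q⁻ C′ ⁅ i* ⁆ (p─q⊆p cluster _ x∈)
      ... | inj₂ x∈i* = contradiction (x∈⁅y⁆⇒x≡y i* x∈i*) (x∈p-y⇒x≢y {p = cluster} x∈)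
      ... | inj₁ x∈C′ = let u , u<b , q = moved-position x∈C′ in within u<b q

      MaxDist≤radius : MaxDist i* cluster ≤ radius
      -- For `b` equal to 0, `cluster - i*` is empty and both sides are the default `0#`.
      MaxDist≤radius with b ℕ.≟ 0
      ... | yes b≡0 = ≤-reflexive (≈.reflexive
        (trans (MaxDist-singleton (trans ∣cluster∣≡1+b (cong suc b≡0)) i*∈cluster) (sym (radius≡0 b≡0))))
      ... | no  b≢0 = MaxDist≤v
        (0<∣p∣⇒Nonempty (cluster - i*)
          (subst (0 <ℕ_) (ℕ.suc-injective (sym (trans (x∈p⇒1+∣p-x∣≡∣p∣ i*∈cluster) ∣cluster∣≡1+b)))
            (ℕ.n≢0⇒n>0 b≢0)))
        d≤radius

      generate-optimal : IsCbest Nₒ (suc b) cluster × IsMinMaxCentroid i* cluster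
      generate-optimal = best-and-centroid radius cluster⊆Nₒ ∣cluster∣≡1+b i*∈cluster MaxDist≤radius optimal

      -- Since `suc b ≤ MaxSize`, at least `G *ℕ k′` points remain.
      generate-feasible : Feasible G k′ (State.Nₒ next) (State.nₒ next)
      generate-feasible = nₒ′≡ , ℕ.m+n≤o⇒m≤o∸n (G *ℕ k′) (begin
        G *ℕ k′ +ℕ suc b  ≤⟨ ℕ.+-monoʳ-≤ (G *ℕ k′) (ℕ.≤-trans (s≤s b≤MaxScan) (ℕ.≤-reflexive 1+MaxScan≡MaxSize)) ⟩
        G *ℕ k′ +ℕ MaxSize ≡⟨ ℕ.m+[n∸m]≡n (ℕ.≤-trans (ℕ.m≤n+m _ G) G+Gk′≤nₒ) ⟩
        nₒ                ∎)
        where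
        open ℕ.≤-Reasoning
        nₒ′≡ : nₒ ∸ suc b ≡ ∣ N′ - i* ∣
        nₒ′≡ = begin-equality
          nₒ ∸ suc b                      ≡⟨ cong (_∸ suc b) nₒ≡∣Nₒ∣ ⟩
          ∣ Nₒ ∣ ∸ suc b                  ≡⟨ cong (_∸ suc b) remaining ⟨
          -- `i*` is still in `N′`, so removing it takes away one more point.
          ∣ N′ ∣ +ℕ b ∸ suc b             ≡⟨ cong (λ m → m +ℕ b ∸ suc b) (x∈p⇒1+∣p-x∣≡∣p∣ (untouched i*∈Nₒ (i∉order i*))) ⟨
          suc ∣ N′ - i* ∣ +ℕ b ∸ suc b    ≡⟨ cong (_∸ suc b) (ℕ.+-suc ∣ N′ - i* ∣ b) ⟨
          ∣ N′ - i* ∣ +ℕ suc b ∸ suc b    ≡⟨ ℕ.m+n∸n≡m ∣ N′ - i* ∣ (suc b) ⟩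
          ∣ N′ - i* ∣                     ∎

    iteration-correct : ∀ {out} → iteration ≡ just out →
                        let open Outcome out in
                        IsLargestAdmissible i* (suc BestScan)
                        × IsCbest Nₒ (suc BestScan) cluster
                        × IsMinMaxCentroid i* cluster
                        × Feasible G k′ (State.Nₒ next) (State.nₒ next)
    iteration-correct eq with map-just⁻ choose eq
    ... | (i* , b) , choose≡ , refl =
      let choice = choose-choice choose≡
          best , centroid = generate-optimal choice
      in  Choice.largest choice , best , centroid , generate-feasible choice

    -- Existence of a centre when `lam` lies between 0 and 1.

    module _ (0≤lam : 0# ≤ lam) (lam≤1 : lam ≤ 1#) (0<Large : 0# < Large) (d<Large : ∀ i j → d i j < Large) where

      module _ (0<MinScan : 0 <ℕ MinScan) where

        examined : Fin n → Phase1Best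
        examined i = record { BestDistance = Distance ; BestMinGap = MinGap ; BestSumGap = SumGap }
          where
          open Phase1Vars (phase1 i)

        -- Both outcomes keep only a weak comparison of distances; a tie, however the gaps decide
        -- it, fits either.
        phase1Update-elim : ∀ (P : Phase1Best → Set p) b i →
                            (Phase1Vars.Distance (phase1 i) ≤ Phase1Best.BestDistance b → P (examined i)) →
                            (Phase1Best.BestDistance b ≤ Phase1Vars.Distance (phase1 i) → P b) →
                            P (phase1Update b i)
        phase1Update-elim P b i f g = if-elim P
          ((Distance <? BestDistance) ⊎-dec ((Distance ≟ BestDistance) ×-dec (BestMinGap <? MinGap)))
          (λ better → f ([ proj₁ , ≤-reflexive ∘ proj₁ ]′ better))
          (λ ¬better → g (≮⇒≥ (¬better ∘ inj₁)))
          where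
          open Phase1Best b
          open Phase1Vars (phase1 i)

        phase1Best-≤ : ∀ {i} → i ∈ Nₒ → Phase1Best.BestDistance phase1Best ≤ Phase1Vars.Distance (phase1 i)
        phase1Best-≤ i∈ = foldl-absorbs (λ b i → Phase1Best.BestDistance b ≤ Phase1Vars.Distance (phase1 i))
          (λ b i → phase1Update-elim (λ b′ → Phase1Best.BestDistance b′ ≤ Phase1Vars.Distance (phase1 i)) b i
            (λ _ → ≤-refl) id)
          (λ b i i′ b≤ → phase1Update-elim (λ b′ → Phase1Best.BestDistance b′ ≤ Phase1Vars.Distance (phase1 i′)) b i
            (λ i≤b → ≤-trans i≤b b≤) (λ _ → b≤))
          (members Nₒ) (∈-members⁺ i∈)

        -- Were `BestDistance` still `Large`, then `Large` would be at most the Phase 1 distance of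
        -- some available point, but that is a value of `d`.
        phase1Best-examined : ∃[ i ] (i ∈ Nₒ × phase1Best ≡ examined i)
        phase1Best-examined with foldl-preserves Known (members Nₒ)
          (λ b i i∈ known → phase1Update-elim Known b i (λ _ → inj₂ (i , ∈-members⁻ i∈ , refl)) (λ _ → known))
          (inj₁ refl)
          where
          Known : Phase1Best → Set c
          Known b = Phase1Best.BestDistance b ≡ Large ⊎ ∃[ i ] (i ∈ Nₒ × b ≡ examined i)
        ... | inj₂ known = known
        ... | inj₁ best≡Large =
          let i , i∈ = 0<∣p∣⇒Nonempty Nₒ (ℕ.≤-<-trans z≤n MaxScan<∣Nₒ∣)
              j , _ , distance≡ = phase1-distance 0<MinScan i∈
          in  contradiction (subst₂ _≤_ best≡Large distance≡ (phase1Best-≤ i∈)) (<⇒≱ (d<Large i j))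

        0≤TargetGap : 0# ≤ TargetGap
        0≤TargetGap with i , _ , eq ← phase1Best-examined rewrite eq =
          0≤x+y (*-nonNegative 0≤lam (0≤x/m (MinScan ∸ 1) 0≤SumGap SumGap≡0))
                (*-nonNegative (x≤y⇒0≤y−x lam≤1) 0≤MinGap)
          where
          open NonNegativeGaps (phase1-gaps i (proj₁ 0<Large) 0<MinScan)

        -- The point behind `BestDistance` has its available point at position `MinScan ∸ 1` at
        -- exactly that distance, which a nonnegative `TargetGap` keeps within `DistanceLimit`.
        best-scan : ∃[ i ] (i ∈ Nₒ × MinScan ≤ℕ scan i)
        best-scan =
          let i , i∈ , best≡ = phase1Best-examined
              j , q , distance≡ = phase1-distance 0<MinScan i∈
              1+m₀≡ = 1+m₀≡MinScan 0<MinScan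
              m₀< = scan-maximal 0<MinScan i∈ (ℕ.≤-reflexive (sym 1+m₀≡))
                      (ℕ.≤-trans (ℕ.≤-reflexive 1+m₀≡) MinScan≤MaxScan) q
                      (subst (_≤ DistanceLimit) (trans (cong Phase1Best.BestDistance best≡) distance≡) (0≤y⇒x≤x+y 0≤TargetGap))
          in  i , i∈ , subst (_≤ℕ scan i) 1+m₀≡ m₀<

        -- Without a centre `BestScan` would still be `MinScan ∸ 1`, although it is at least the
        -- count of a point that reaches `MinScan`.
        centre-found : ∃[ i ] Phase2Best.centre phase2Best ≡ just i
        centre-found with phase2Best-recorded
        ... | some {i} _ _ eq = i , cong Phase2Best.centre eq
        ... | none _ BestScan≡ =
          let i , i∈ , M≤ = best-scan
              T≤ = [ ℕ.<⇒≤ , ℕ.≤-reflexive ∘ proj₁ ]′ (phase2Best-dominates i∈ M≤)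
          in  contradiction (ℕ.≤-trans M≤ (subst (scan i ≤ℕ_) BestScan≡ T≤))
                (ℕ.<⇒≱ (ℕ.≤-reflexive (1+m₀≡MinScan 0<MinScan)))

      iteration-succeeds : ∃[ out ] iteration ≡ just out
      iteration-succeeds = if-elim (λ chosen → ∃[ out ] Maybe.map generate chosen ≡ just out) (MinScan ℕ.≟ 0)
        (λ _ → let i , i∈ = 0<∣p∣⇒Nonempty Nₒ (ℕ.≤-<-trans z≤n MaxScan<∣Nₒ∣)
                   j , head≡ = ∈⇒head (∈-members⁺ i∈)
               in  _ , cong (Maybe.map generate ∘ Maybe.map (_, 0)) head≡)
        (λ MinScan≢0 → let i , centre≡ = centre-found (ℕ.n≢0⇒n>0 MinScan≢0)
                       in  _ , cong (Maybe.map generate ∘ Maybe.map (_, Phase2Best.BestScan phase2Best)) centre≡)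

-- Correctness and completion of the whole run.

theorem2 : ∀ {c ℓ₁ ℓ₂ : Level} (F : OrderedField c ℓ₁ ℓ₂) →
    let open OrderedField F in
    (n k G : ℕ) (d : Fin n → Fin n → Carrier) →
    (∀ i → d i i ≈ 0#) →
    1 ≤ℕ k → k ≤ℕ n →
    1 ≤ℕ G → G *ℕ k ≤ℕ n →
    (lam Large : Carrier) →
    0# < Large → (∀ i j → d i j < Large) →
    (order : Fin n → List (Fin n)) →
    let open Spans F d in
    (∀ i → IsOrdering i (order i)) →
    let open Method F d k G lam Large order in
    (∀ kₒ σ out → 1 ≤ℕ kₒ → Reached kₒ σ →
    let open Iteration kₒ σ in
    let open State σ in
    let open Outcome out in
    let v* = suc BestScan in
    iteration ≡ just out →
    nₒ ≡ ∣ Nₒ ∣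
    × IsLargestAdmissible i* v*
    × IsCbest Nₒ v* cluster
    × IsMinMaxCentroid i* cluster)
    ×
    (0# ≤ lam → lam ≤ 1# →
    ∀ kₒ → 1 ≤ℕ kₒ → kₒ ≤ℕ k →
    ∃[ σ ] ∃[ out ] (Reached kₒ σ × Iteration.iteration kₒ σ ≡ just out))
theorem2 F n k G d _ _ _ 1≤G Gk≤n lam Large 0<Large d<Large order ordering = correct , succeeds
  where
  open OrderedField F
  open Spans F d
  open Method F d k G lam Large order
  open module Step (k′ : ℕ) (σ : State) = IterationProperties F d k G lam Large order ordering k′ σ
    using (iteration-correct; iteration-succeeds)

  reached⇒feasible : ∀ {kₒ σ} → Reached kₒ σ → Feasible G kₒ (State.Nₒ σ) (State.nₒ σ)
  reached⇒feasible start = sym (∣⊤∣≡n n) , Gk≤n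
  -- The invariant is handed on by the last component of `iteration-correct`.
  reached⇒feasible (step {kₒ} {σ} reached eq) =
    proj₂ (proj₂ (proj₂ (iteration-correct kₒ σ 1≤G (reached⇒feasible reached) eq)))

  correct : ∀ kₒ σ out → 1 ≤ℕ kₒ → Reached kₒ σ →
            let open Iteration kₒ σ in
            let open State σ in
            let open Outcome out in
            iteration ≡ just out →
            nₒ ≡ ∣ Nₒ ∣ × IsLargestAdmissible i* (suc BestScan)
            × IsCbest Nₒ (suc BestScan) cluster × IsMinMaxCentroid i* cluster
  correct (suc k′) σ out _ reached eq =
    let feasible = reached⇒feasible reached
        largest , best , centroid , _ = iteration-correct k′ σ 1≤G feasible eq
    in  proj₁ feasible , largest , best , centroid

  succeeds : 0# ≤ lam → lam ≤ 1# → ∀ kₒ → 1 ≤ℕ kₒ → kₒ ≤ℕ k →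
             ∃[ σ ] ∃[ out ] (Reached kₒ σ × Iteration.iteration kₒ σ ≡ just out)
  succeeds 0≤lam lam≤1 (suc k′) _ kₒ≤k =
    let σ , reached = reachable (k ∸ suc k′) (ℕ.m∸n+n≡m kₒ≤k)
        out , eq = next k′ σ reached
    in  σ , out , reached , eq
    where
    next : ∀ k′ σ → Reached (suc k′) σ → ∃[ out ] Iteration.iteration (suc k′) σ ≡ just out
    next k′ σ reached = iteration-succeeds k′ σ 1≤G (reached⇒feasible reached) 0≤lam lam≤1 0<Large d<Large

    -- `m` counts the iterations completed before iteration `kₒ`, as the run descends from `k`.
    reachable : ∀ m {kₒ} → m +ℕ kₒ ≡ k → ∃[ σ ] Reached kₒ σ
    reachable zero    refl = ⟨ _ , _ ⟩ , start
    reachable (suc m) {kₒ} eq =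
      let σ , reached = reachable m (trans (ℕ.+-suc m kₒ) eq)
          out , eq′ = next kₒ σ reached
      in  Outcome.next out , step reached eq′
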